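{- Let $p \ge 5$ be an odd prime. Then $a'(K_{p^2,p^2}) = p^2+2 = \Delta+2$, where $\Delta = p^2$ is the maximum degree of $K_{p^2,p^2}$.
   Context: For a finite simple graph $G$, a proper edge-coloring assigns colors to edges so that adjacent edges receive different colors. An acyclic edge-coloring is a proper edge-coloring with no bichromatic (2-colored) cycle. The acyclic chromatic index $a'(G)$ is the least integer $k$ such that $G$ admits an acyclic edge-coloring using $k$ colors. $K_{n,n}$ denotes the complete bipartite graph with $n$ vertices on each side. -}

module Defs where

open import Data.Nat using (ℕ; suc; _+_; _<_; _≤_)
open import Data.Fin using (Fin; zero; suc; toℕ; inject₁; fromℕ)
open import Data.Fin.Properties using ()
open import Data.Nat.Properties using (≤-irrelevant; <⇒≱)
open import Relation.Binary.PropositionalEquality using (refl; cong₂)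
open import Data.Sum using (_⊎_; inj₁; inj₂)
open import Data.Product using (Σ; ∃; _×_; _,_)
open import Data.Empty using (⊥; ⊥-elim)
open import Data.Unit using (⊤; tt)
open import Relation.Nullary using (¬_)
open import Relation.Binary.PropositionalEquality using (_≡_; _≢_)
open import Function.Definitions using (Injective)

record Graph : Set₁ where
  field
    n     : ℕ
    Adj   : Fin n → Fin n → Set
    sym   : ∀ {u v} → Adj u v → Adj v u
    irrefl : ∀ {u} → ¬ Adj u u
    unique : ∀ {u v} (e e′ : Adj u v) → e ≡ e′

open Graph public

-- An edge-colouring with k colours: each edge (unordered) gets a colour,
-- so the colour does not depend on the orientation of the edge.
record EdgeColoring (G : Graph) (k : ℕ) : Set where
  field
    col    : ∀ {u v} → Adj G u v → Fin k
    colSym : ∀ {u v} (e : Adj G u v) → col (sym G e) ≡ col e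

open EdgeColoring public

Proper : ∀ {G k} → EdgeColoring G k → Set
Proper {G} c = ∀ {u v w} (e : Adj G u v) (f : Adj G u w) →
  col c e ≡ col c f → v ≡ w

record Cycle (G : Graph) : Set where
  field
    r      : ℕ
    x      : Fin (suc (suc (suc r))) → Fin (n G)
    inj    : Injective _≡_ _≡_ x
    step   : (i : Fin (suc (suc r))) → Adj G (x (inject₁ i)) (x (suc i))
    close  : Adj G (x (fromℕ (suc (suc r)))) (x zero)

open Cycle public

Bichromatic : ∀ {G k} → EdgeColoring G k → Cycle G → Set
Bichromatic {G} {k} c C = Σ (Fin k) λ a → Σ (Fin k) λ b →
  (∀ i → col c (step C i) ≡ a ⊎ col c (step C i) ≡ b) ×
  (col c (close C) ≡ a ⊎ col c (close C) ≡ b)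

Acyclic : ∀ {G k} → EdgeColoring G k → Set
Acyclic {G} c = Proper c × (∀ (C : Cycle G) → ¬ Bichromatic c C)

AcyclicColorable : Graph → ℕ → Set
AcyclicColorable G k = Σ (EdgeColoring G k) Acyclic

AcyclicChromaticIndex : Graph → ℕ → Set
AcyclicChromaticIndex G k =
  AcyclicColorable G k × (∀ j → j < k → ¬ AcyclicColorable G j)

AdjK : ∀ m → Fin (m + m) → Fin (m + m) → Set
AdjK m u v = (toℕ u < m × m ≤ toℕ v) ⊎ (m ≤ toℕ u × toℕ v < m)

private
  symK : ∀ m {u v} → AdjK m u v → AdjK m v u
  symK m (inj₁ (a , b)) = inj₂ (b , a)
  symK m (inj₂ (a , b)) = inj₁ (b , a)

  irreflK : ∀ m {u} → ¬ AdjK m u u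
  irreflK m (inj₁ (a , b)) = <⇒≱ a b
  irreflK m (inj₂ (a , b)) = <⇒≱ b a

  uniqueK : ∀ m {u v} (e e′ : AdjK m u v) → e ≡ e′
  uniqueK m (inj₁ (a , b)) (inj₁ (a′ , b′)) =
    Relation.Binary.PropositionalEquality.cong inj₁
      (cong₂ _,_ (≤-irrelevant a a′) (≤-irrelevant b b′))
  uniqueK m (inj₁ (a , b)) (inj₂ (a′ , b′)) = ⊥-elim (<⇒≱ a a′)
  uniqueK m (inj₂ (a , b)) (inj₁ (a′ , b′)) = ⊥-elim (<⇒≱ a′ a)
  uniqueK m (inj₂ (a , b)) (inj₂ (a′ , b′)) =
    Relation.Binary.PropositionalEquality.cong inj₂
      (cong₂ _,_ (≤-irrelevant a a′) (≤-irrelevant b b′))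

K : ℕ → Graph
K m = record { n = m + m ; Adj = AdjK m ; sym = symK m
             ; irrefl = irreflK m ; unique = uniqueK m }

{-# OPTIONS --safe #-}
module Submission where

-- Lower bound. If n = p² is odd and n + 1 colours suffice, counting shows that one colour M is a perfect
-- matching and that every other colour misses one vertex on each side. Completing the colour classes by a
-- new vertex on each side gives permutations of n + 1 points. Let A miss the vertex o and its counterpart v,
-- and let C be the colour of the edge o v; then M, A and C differ pairwise by a single (n + 1)-cycle, which
-- is an odd permutation, contradicting the multiplicativity of the sign.
--
-- Upper bound. Let N be a non-square modulo p = 2m + 1 and let both sides be Z_p × Z_p. The base colour
-- (x , y) joins (i , t) to (j , s) when t - j = x + y[i = 0] and s - i = y + N x[j = 0]. Any two base
-- colours form a Hamiltonian cycle, because y² - N x² has no non-trivial zero. One edge of every base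
-- colour is moved to one of two new colours, all of whose edges satisfy s = -2t: P joins the block i = l + 1
-- to j = l + 1 for l < m, and Q joins i = m + l to j = l + 1 for l ≤ m. A cycle in P or Q and a base colour
-- would give an orbit of l ↦ -2l + c modulo p inside an interval shorter than p / 2.

open import Data.Product using (∃; _×_; _,_; proj₁; proj₂)
open import Data.Sum as Sum using (_⊎_; inj₁; inj₂)
open import Data.Empty using (⊥; ⊥-elim)
open import Relation.Nullary using (¬_; Dec; yes; no)
open import Relation.Binary.PropositionalEquality using (_≡_; _≢_; refl; sym; trans; cong; cong₂; subst; subst₂; module ≡-Reasoning)

-- Any two of the p² base colours form a Hamiltonian cycle, so every base colour but possibly one
-- must lose an edge, and the lost edges have to be acyclic against everything else. Away from block
-- 0 the colour (x , y) has t = j + x and s = i + y, so s = -2t selects i + 2j = -2x - y. On the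
-- diagonal i = j = k + 1 this is 3k = -3 - 2x - y modulo p, which has one solution k because p is
-- not 3. A single new colour on the whole diagonal would bring in block 0 at k = 2m, and its range
-- would be too long for the orbit argument. Hence the diagonal is cut at k = m. For k = m + l the
-- pair (i , j) is lowered by (1 , m), which changes i + 2j by exactly p and gives the blocks of Q,
-- all of them nonzero.

module Injections where

  open import Data.Bool using (Bool; true; false; not)
  open import Data.Nat using (ℕ; zero; suc; _+_; _*_; _∸_; _≤_; _<_; _<ᵇ_; z≤n; s≤s; _%_; _/_)
  open import Data.Nat.Properties using (+-0-commutativeMonoid; +-comm; +-identityʳ; *-comm; ≤-trans; <⇒≤; ≤⇒≯; n<1+n; m∸n+n≡m; m<n⇒0<n∸m; m∸n≤m; ≤-pred)
  open import Data.Nat.DivMod using (m≡m%n+[m/n]*n; m%n<n)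
  open import Data.Nat.Tactic.RingSolver using (solve-∀)
  open import Data.Fin using (Fin; zero; suc; toℕ; fromℕ; fromℕ<; inject₁; punchOut)
  open import Data.Fin.Properties using (any?; _≟_; ¬∀⟶∃¬; injective⇒≤; punchOut-injective; pigeonhole; toℕ<n; toℕ-injective; toℕ-fromℕ; toℕ-fromℕ<; toℕ-inject₁)
  open import Data.Fin.Permutation using (Permutation; permutation)
  open import Function using (_∘_; id)
  open import Function.Definitions using (Injective)
  open import Algebra.Properties.CommutativeMonoid.Sum +-0-commutativeMonoid using (sum; sum-cong-≗; ∑-distrib-+; sum-permute)

  -- Injections and surjections of finite sets.

  Inj : ∀ {m n} → (Fin m → Fin n) → Set
  Inj f = Injective _≡_ _≡_ f

  Onto : ∀ {m n} → (Fin m → Fin n) → Set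
  Onto f = ∀ y → ∃ λ x → f x ≡ y

  onto⇒≤ : ∀ {m n} {f : Fin m → Fin n} → Onto f → n ≤ m
  onto⇒≤ {f = f} s = injective⇒≤ {f = λ y → proj₁ (s y)}
    (λ {y} {y′} e → trans (sym (proj₂ (s y))) (trans (cong f e) (proj₂ (s y′))))

  abstract
    missed-value : ∀ {m n} (f : Fin m → Fin n) → m < n → ∃ λ y → ∀ x → f x ≢ y
    missed-value {m} {n} f m<n
      with ¬∀⟶∃¬ n (λ y → ∃ λ x → f x ≡ y) (λ y → any? (λ x → f x ≟ y)) (λ s → ≤⇒≯ (onto⇒≤ s) m<n)
    ... | y , ¬h = y , λ x e → ¬h (x , e)

    inj⇒onto : ∀ {n} {f : Fin n → Fin n} → Inj f → Onto f
    inj⇒onto {suc n} {f} f-inj y with any? (λ x → f x ≟ y)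
    ... | yes h = h
    ... | no ¬h = ⊥-elim (≤⇒≯ (injective⇒≤ {f = λ x → punchOut (y≢ x)}
                          (λ {x} {x′} e → f-inj (punchOut-injective (y≢ x) (y≢ x′) e))) (n<1+n n))
      where
      y≢ : ∀ x → y ≢ f x
      y≢ x e = ¬h (x , sym e)

    onto⇒inj : ∀ {n} {f : Fin n → Fin n} → Onto f → Inj f
    onto⇒inj {f = f} s {x} {x′} e
      with inj⇒onto {f = λ y → proj₁ (s y)}
             (λ {y} {y′} q → trans (sym (proj₂ (s y))) (trans (cong f q) (proj₂ (s y′))))
    ... | t with t x | t x′
    ...   | y , refl | y′ , refl = cong (λ z → proj₁ (s z)) (trans (sym (proj₂ (s y))) (trans e (proj₂ (s y′))))

  least : (P : ℕ → Set) → (∀ k → Dec (P k)) → ∀ n → P n →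
    ∃ λ m → m ≤ n × P m × (∀ j → j < m → ¬ P j)
  least P P? zero p = zero , z≤n , p , λ j ()
  least P P? (suc n) p with P? zero
  ... | yes p₀ = zero , z≤n , p₀ , λ j ()
  ... | no ¬p₀ with least (P ∘ suc) (P? ∘ suc) n p
  ...   | m , m≤n , pm , min = suc m , s≤s m≤n , pm , λ { zero _ → ¬p₀ ; (suc j) (s≤s j<m) → min j j<m }

  -- Orbits of an injection of a finite set.

  iter : {A : Set} → (A → A) → ℕ → A → A
  iter f zero    x = x
  iter f (suc k) x = f (iter f k x)

  iter-+ : {A : Set} (f : A → A) (j k : ℕ) (x : A) → iter f (j + k) x ≡ iter f j (iter f k x)
  iter-+ f zero    k x = refl
  iter-+ f (suc j) k x = cong f (iter-+ f j k x)

  iter-fixed : {A : Set} (f : A → A) (j k : ℕ) (x : A) → iter f k x ≡ x → iter f (j * k) x ≡ x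
  iter-fixed f zero    k x e = refl
  iter-fixed f (suc j) k x e = trans (iter-+ f k (j * k) x) (trans (cong (iter f k) (iter-fixed f j k x e)) e)

  iter-inj : ∀ {n} {f : Fin n → Fin n} → Inj f → ∀ k → Inj (iter f k)
  iter-inj f-inj zero    e = e
  iter-inj f-inj (suc k) e = iter-inj f-inj k (f-inj e)

  module _ {n : ℕ} {f : Fin n → Fin n} (f-inj : Inj f) (x : Fin n) where

    abstract
      -- Among the iterates 0, ..., n two coincide, and injectivity cancels the common initial
      -- steps, so the orbit closes up at `x` itself.
      return : ∃ λ k → suc k ≤ n × iter f (suc k) x ≡ x
      return with pigeonhole (n<1+n n) (λ i → iter f (toℕ i) x)
      ... | i , j , i<j , e = lemma (toℕ j ∸ toℕ i) refl (m<n⇒0<n∸m i<j)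
        where
        lemma : ∀ d → toℕ j ∸ toℕ i ≡ d → 0 < d → ∃ λ k → suc k ≤ n × iter f (suc k) x ≡ x
        lemma (suc k) eq _ = k ,
          ≤-trans (subst (_≤ toℕ j) eq (m∸n≤m (toℕ j) (toℕ i))) (≤-pred (toℕ<n j)) ,
          sym (iter-inj f-inj (toℕ i) (trans e (trans
            (cong (λ q → iter f q x) (trans (sym (m∸n+n≡m (<⇒≤ i<j))) (trans (cong (_+ toℕ i) eq) (+-comm (suc k) (toℕ i)))))
            (iter-+ f (toℕ i) (suc k) x))))

    period : ℕ
    period = suc (proj₁ return)

    iter-% : ∀ q → iter f q x ≡ iter f (q % period) x
    iter-% q = trans (cong (λ k → iter f k x) (m≡m%n+[m/n]*n q period))
      (trans (iter-+ f (q % period) (q / period * period) x)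
        (cong (iter f (q % period)) (iter-fixed f (q / period) period x (proj₂ (proj₂ return)))))

    abstract
      -- The orbit is exhausted by its first `period` points, so a finite search turns the
      -- refutation of avoidance into an explicit index.
      reach? : ∀ z → ¬ (∀ q → iter f q x ≢ z) → ∃ λ q → iter f q x ≡ z
      reach? z h with any? {n = period} (λ i → iter f (toℕ i) x ≟ z)
      ... | yes (i , e) = toℕ i , e
      ... | no ¬e = ⊥-elim (h λ q e → ¬e (fromℕ< (m%n<n q period) ,
              trans (cong (λ k → iter f k x) (toℕ-fromℕ< (m%n<n q period))) (trans (sym (iter-% q)) e)))

  abstract
    -- Orbits are cycles: `q` steps are undone by `q` times (period - 1) further ones, `q` full
    -- periods in all.
    reach-back : ∀ {n} {f : Fin n → Fin n} → Inj f → ∀ {x z} q → iter f q x ≡ z → ∃ λ r → iter f r z ≡ x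
    reach-back {f = f} f-inj {x} {z} q e =
      q * proj₁ (return f-inj x) , trans (cong (iter f (q * proj₁ (return f-inj x))) (sym e))
        (trans (sym (iter-+ f (q * proj₁ (return f-inj x)) q x))
          (trans (cong (λ k → iter f k x) (lemma q (proj₁ (return f-inj x))))
            (iter-fixed f q _ x (proj₂ (proj₂ (return f-inj x))))))
      where
      lemma : ∀ q k → q * k + q ≡ q * suc k
      lemma = solve-∀

  -- The sign of a permutation, by counting inversions.

  lt : ∀ {m n} → (Fin m → Fin n) → Fin m → Fin m → Bool
  lt f i j = toℕ (f i) <ᵇ toℕ (f j)

  differ : Bool → Bool → ℕ
  differ false false = 0
  differ true  true  = 0
  differ _     _     = 1

  odd-one : Bool → Bool → Bool → ℕ
  odd-one false true  false = 1
  odd-one true  false true  = 1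
  odd-one _     _     _     = 0

  -- If `b` agrees with neither `a` nor `c`, then `a` equals `c` and two differences cancel; in
  -- every other case `differ` is additive.
  differ-triangle : ∀ a b c → differ a b + differ b c ≡ differ a c + 2 * odd-one a b c
  differ-triangle false false false = refl
  differ-triangle false false true  = refl
  differ-triangle false true  false = refl
  differ-triangle false true  true  = refl
  differ-triangle true  false false = refl
  differ-triangle true  false true  = refl
  differ-triangle true  true  false = refl
  differ-triangle true  true  true  = refl

  differ-sym : ∀ a b → differ a b ≡ differ b a
  differ-sym false false = refl
  differ-sym false true  = refl
  differ-sym true  false = refl
  differ-sym true  true  = refl

  differ-not : ∀ a b → differ (not a) (not b) ≡ differ a b
  differ-not false false = refl
  differ-not false true  = refl
  differ-not true  false = refl
  differ-not true  true  = refl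

  odd-one-not : ∀ a b c → odd-one (not a) (not b) (not c) ≡ odd-one a b c
  odd-one-not false false false = refl
  odd-one-not false false true  = refl
  odd-one-not false true  false = refl
  odd-one-not false true  true  = refl
  odd-one-not true  false false = refl
  odd-one-not true  false true  = refl
  odd-one-not true  true  false = refl
  odd-one-not true  true  true  = refl

  <ᵇ-irrefl : ∀ k → (k <ᵇ k) ≡ false
  <ᵇ-irrefl zero    = refl
  <ᵇ-irrefl (suc k) = <ᵇ-irrefl k

  <ᵇ-flip : ∀ j k → j ≢ k → (k <ᵇ j) ≡ not (j <ᵇ k)
  <ᵇ-flip zero    zero    j≢k = ⊥-elim (j≢k refl)
  <ᵇ-flip zero    (suc k) _   = refl
  <ᵇ-flip (suc j) zero    _   = refl
  <ᵇ-flip (suc j) (suc k) j≢k = <ᵇ-flip j k (j≢k ∘ cong suc)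

  lt-flip : ∀ {m n} {f : Fin m → Fin n} → Inj f → ∀ {i j} → i ≢ j → lt f j i ≡ not (lt f i j)
  lt-flip f-inj i≢j = <ᵇ-flip _ _ (λ e → i≢j (f-inj (toℕ-injective e)))

  ∑∑ : ∀ {n} → (Fin n → Fin n → ℕ) → ℕ
  ∑∑ F = sum (λ i → sum (F i))

  ∑∑-cong : ∀ {n} {F G : Fin n → Fin n → ℕ} → (∀ i j → F i j ≡ G i j) → ∑∑ F ≡ ∑∑ G
  ∑∑-cong e = sum-cong-≗ (λ i → sum-cong-≗ (e i))

  ∑∑-+ : ∀ {n} (F G : Fin n → Fin n → ℕ) → ∑∑ (λ i j → F i j + G i j) ≡ ∑∑ F + ∑∑ G
  ∑∑-+ F G = trans (sum-cong-≗ (λ i → ∑-distrib-+ (F i) (G i))) (∑-distrib-+ (λ i → sum (F i)) (λ i → sum (G i)))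

  ∑∑-permute : ∀ {n} (F : Fin n → Fin n → ℕ) {h : Fin n → Fin n} → Inj h → ∑∑ (λ i j → F (h i) (h j)) ≡ ∑∑ F
  ∑∑-permute F {h} h-inj = sym (trans (sum-permute (λ i → sum (F i)) π) (sum-cong-≗ (λ i → sum-permute (F (h i)) π)))
    where
    π : Permutation _ _
    π = permutation h (λ y → proj₁ (inj⇒onto h-inj y)) (λ y → proj₂ (inj⇒onto h-inj y))
          (λ x → h-inj (proj₂ (inj⇒onto h-inj (h x))))

  ∑∑-even : ∀ {n} (F : Fin n → Fin n → ℕ) → (∀ i → F i i ≡ 0) → (∀ i j → F i j ≡ F j i) → ∃ λ v → ∑∑ F ≡ 2 * v
  ∑∑-even {zero}  F diag symm = 0 , refl
  ∑∑-even {suc n} F diag symm with ∑∑-even (λ i j → F (suc i) (suc j)) (λ i → diag (suc i)) (λ i j → symm (suc i) (suc j))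
  ... | v , e = row + v , (begin
      F zero zero + row + sum (λ i → F (suc i) zero + sum (λ j → F (suc i) (suc j)))
        ≡⟨ cong₂ _+_ (cong (_+ row) (diag zero)) (∑-distrib-+ (λ i → F (suc i) zero) (λ i → sum (λ j → F (suc i) (suc j)))) ⟩
      row + (sum (λ i → F (suc i) zero) + ∑∑ (λ i j → F (suc i) (suc j)))
        ≡⟨ cong (row +_) (cong₂ _+_ (sum-cong-≗ (λ i → symm (suc i) zero)) e) ⟩
      row + (row + 2 * v)
        ≡⟨ lemma row v ⟩
      2 * (row + v) ∎)
    where
    open ≡-Reasoning
    row = sum (λ j → F zero (suc j))
    lemma : ∀ r v → r + (r + 2 * v) ≡ 2 * (r + v)
    lemma = solve-∀

  -- Pairs ordered differently by f and g; every unordered pair is counted twice, so the sign is read modulo 4.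
  inversions : ∀ {n} → (f g : Fin n → Fin n) → ℕ
  inversions f g = ∑∑ (λ i j → differ (lt f i j) (lt g i j))

  inversions-sym : ∀ {n} (f g : Fin n → Fin n) → inversions f g ≡ inversions g f
  inversions-sym f g = ∑∑-cong (λ i j → differ-sym (lt f i j) (lt g i j))

  inversions-∘ : ∀ {n} (f g : Fin n → Fin n) {h} → Inj h → inversions (f ∘ h) (g ∘ h) ≡ inversions f g
  inversions-∘ f g = ∑∑-permute (λ i j → differ (lt f i j) (lt g i j))

  inversions-even : ∀ {n} {f g : Fin n → Fin n} → Inj f → Inj g → ∃ λ v → inversions f g ≡ 2 * v
  inversions-even {f = f} {g} f-inj g-inj = ∑∑-even _
    (λ i → cong₂ differ (<ᵇ-irrefl (toℕ (f i))) (<ᵇ-irrefl (toℕ (g i)))) symm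
    where
    symm : ∀ i j → differ (lt f i j) (lt g i j) ≡ differ (lt f j i) (lt g j i)
    symm i j with i ≟ j
    ... | yes refl = refl
    ... | no i≢j rewrite lt-flip f-inj i≢j | lt-flip g-inj i≢j = sym (differ-not (lt f i j) (lt g i j))

  -- The defect 2 * `odd-one` is symmetric in the pair and zero on the diagonal, so it sums to a
  -- multiple of 4. Thus half of `inversions` is additive modulo 2, which is the multiplicativity of
  -- the sign.
  inversions-triangle : ∀ {n} {f g h : Fin n → Fin n} → Inj f → Inj g → Inj h →
    ∃ λ v → inversions f g + inversions g h ≡ inversions f h + 4 * v
  inversions-triangle {f = f} {g} {h} f-inj g-inj h-inj
    with ∑∑-even (λ i j → odd-one (lt f i j) (lt g i j) (lt h i j)) diag symm
    where
    diag : ∀ i → odd-one (lt f i i) (lt g i i) (lt h i i) ≡ 0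
    diag i rewrite <ᵇ-irrefl (toℕ (f i)) | <ᵇ-irrefl (toℕ (g i)) = cong (odd-one false false) (<ᵇ-irrefl (toℕ (h i)))
    symm : ∀ i j → odd-one (lt f i j) (lt g i j) (lt h i j) ≡ odd-one (lt f j i) (lt g j i) (lt h j i)
    symm i j with i ≟ j
    ... | yes refl = refl
    ... | no i≢j rewrite lt-flip f-inj i≢j | lt-flip g-inj i≢j | lt-flip h-inj i≢j =
      sym (odd-one-not (lt f i j) (lt g i j) (lt h i j))
  ... | v , e = v , (begin
      inversions f g + inversions g h
        ≡⟨ sym (∑∑-+ (λ i j → differ (lt f i j) (lt g i j)) (λ i j → differ (lt g i j) (lt h i j))) ⟩
      ∑∑ (λ i j → differ (lt f i j) (lt g i j) + differ (lt g i j) (lt h i j))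
        ≡⟨ ∑∑-cong (λ i j → differ-triangle (lt f i j) (lt g i j) (lt h i j)) ⟩
      ∑∑ (λ i j → differ (lt f i j) (lt h i j) + 2 * odd-one (lt f i j) (lt g i j) (lt h i j))
        ≡⟨ ∑∑-+ (λ i j → differ (lt f i j) (lt h i j)) (λ i j → 2 * O i j) ⟩
      inversions f h + ∑∑ (λ i j → 2 * O i j)
        ≡⟨ cong (inversions f h +_) (trans (∑∑-+ O (λ i j → O i j + 0)) (cong₂ _+_ e (trans (∑∑-cong (λ i j → +-identityʳ (O i j))) e))) ⟩
      inversions f h + (2 * v + 2 * v)
        ≡⟨ cong (inversions f h +_) (lemma v) ⟩
      inversions f h + 4 * v ∎)
    where
    open ≡-Reasoning
    O : Fin _ → Fin _ → ℕ
    O i j = odd-one (lt f i j) (lt g i j) (lt h i j)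
    lemma : ∀ v → 2 * v + 2 * v ≡ 4 * v
    lemma = solve-∀

  rot : ∀ {n} → Fin (suc n) → Fin (suc n)
  rot zero    = fromℕ _
  rot (suc i) = inject₁ i

  -- `rot` is the cyclic predecessor map. It reverses exactly the `n` pairs containing zero, each
  -- counted in both orders.
  inversions-rot : ∀ n → inversions {suc n} id rot ≡ 2 * n
  inversions-rot n = begin
    sum (λ j → D zero j) + sum {n} (λ i → sum (D (suc i)))
      ≡⟨ cong₂ _+_ first (trans (sum-cong-≗ {n} rest) (sum-const n 1)) ⟩
    n * 1 + n * 1
      ≡⟨ lemma n ⟩
    2 * n ∎
    where
    open ≡-Reasoning
    D : Fin (suc n) → Fin (suc n) → ℕ
    D i j = differ (lt (λ k → k) i j) (lt rot i j)
    sum-const : ∀ k c → sum {k} (λ _ → c) ≡ k * c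
    sum-const zero    c = refl
    sum-const (suc k) c = cong (c +_) (sum-const k c)
    ≮ᵇ : ∀ {a b} → b ≤ a → (a <ᵇ b) ≡ false
    ≮ᵇ z≤n     = refl
    ≮ᵇ (s≤s q) = ≮ᵇ q
    <ᵇ-true : ∀ {a b} → a < b → (a <ᵇ b) ≡ true
    <ᵇ-true {zero}  (s≤s q) = refl
    <ᵇ-true {suc a} (s≤s q) = <ᵇ-true q
    same : ∀ b → differ b b ≡ 0
    same false = refl
    same true  = refl
    top : ∀ j → D zero (suc j) ≡ 1
    top j rewrite toℕ-inject₁ j | toℕ-fromℕ n = cong (differ true) (≮ᵇ (<⇒≤ (toℕ<n j)))
    left : ∀ i → D (suc i) zero ≡ 1
    left i rewrite toℕ-inject₁ i | toℕ-fromℕ n = cong (differ false) (<ᵇ-true (toℕ<n i))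
    inner : ∀ i j → D (suc i) (suc j) ≡ 0
    inner i j rewrite toℕ-inject₁ i | toℕ-inject₁ j = same (toℕ i <ᵇ toℕ j)
    first : sum (D zero) ≡ n * 1
    first = cong₂ _+_ (cong (differ false) (<ᵇ-irrefl (toℕ (fromℕ n)))) (trans (sum-cong-≗ {n} top) (sum-const n 1))
    rest : ∀ i → sum (D (suc i)) ≡ 1
    rest i = cong₂ _+_ (left i) (trans (sum-cong-≗ {n} (inner i)) (trans (sum-const n 0) (*-comm n 0)))
    lemma : ∀ n → n * 1 + n * 1 ≡ 2 * n
    lemma = solve-∀

-- The sign of a full cycle, and the impossibility of n + 1 colours.

module TooFew where

  open Injections
  open import Data.Nat using (ℕ; zero; suc; _+_; _*_; _<_; _<ᵇ_; _%_)
  open import Data.Nat.Properties using (n<1+n; <-≤-trans; even≢odd; *-cancelˡ-≡; +-cancelˡ-≡)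
  open import Data.Nat.DivMod using (m%n<n)
  open import Data.Nat.Tactic.RingSolver using (solve-∀)
  open import Data.Fin using (Fin; zero; suc; toℕ; fromℕ; fromℕ<; punchOut; punchIn)
  open import Data.Fin.Properties using (any?; _≟_; punchOut-injective; punchOut-cong; toℕ-fromℕ<; toℕ-inject₁; fromℕ≢inject₁; inject₁-injective; punchInᵢ≢i; punchOut-punchIn; suc-injective)
  open import Function using (_∘_)

  rot-inj : ∀ {n} → Inj (rot {n})
  rot-inj {x = zero}  {zero}  e = refl
  rot-inj {x = zero}  {suc j} e = ⊥-elim (fromℕ≢inject₁ e)
  rot-inj {x = suc i} {zero}  e = ⊥-elim (fromℕ≢inject₁ (sym e))
  rot-inj {x = suc i} {suc j} e = cong suc (inject₁-injective e)

  inversions-cong : ∀ {n} {f f′ g g′ : Fin n → Fin n} → (∀ i → f i ≡ f′ i) → (∀ i → g i ≡ g′ i) → inversions f g ≡ inversions f′ g′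
  inversions-cong {f = f} {f′} {g} {g′} e e′ = ∑∑-cong λ i j →
    cong₂ differ (cong₂ (λ a b → toℕ a <ᵇ toℕ b) (e i) (e j)) (cong₂ (λ a b → toℕ a <ᵇ toℕ b) (e′ i) (e′ j))

  -- The path from `h` over the identity and `rot` to `h ∘ rot` has outer legs of equal length 2w,
  -- which together vanish modulo 4; the middle leg is 2n. The two multiples of 4 express the
  -- congruence without subtraction.
  inversions-∘rot : ∀ {n} {h : Fin (suc n) → Fin (suc n)} → Inj h →
    ∃ λ a → ∃ λ b → inversions h (h ∘ rot) + 4 * a ≡ 2 * n + 4 * b
  inversions-∘rot {n} {h} h-inj = combine
    (inversions-even h-inj (λ e → e))
    (inversions-triangle h-inj (λ e → e) rot-inj)
    (inversions-triangle h-inj rot-inj (λ e → rot-inj (h-inj e)))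
    where
    open ≡-Reasoning
    regroup : ∀ t a b → t + 4 * (a + b) ≡ t + 4 * b + 4 * a
    regroup = solve-∀
    swap : ∀ a b c → a + b + c ≡ a + c + b
    swap = solve-∀
    collect : ∀ n w → 2 * w + 2 * n + 2 * w ≡ 2 * n + 4 * w
    collect = solve-∀
    combine : (∃ λ w → inversions h (λ x → x) ≡ 2 * w) →
      (∃ λ v → inversions h (λ x → x) + inversions (λ x → x) (rot {n}) ≡ inversions h rot + 4 * v) →
      (∃ λ v → inversions h rot + inversions rot (h ∘ rot) ≡ inversions h (h ∘ rot) + 4 * v) →
      ∃ λ a → ∃ λ b → inversions h (h ∘ rot) + 4 * a ≡ 2 * n + 4 * b
    combine (w , ew) (v₁ , e₁) (v₂ , e₂) = v₁ + v₂ , w , (begin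
      inversions h (h ∘ rot) + 4 * (v₁ + v₂)
        ≡⟨ regroup (inversions h (h ∘ rot)) v₁ v₂ ⟩
      inversions h (h ∘ rot) + 4 * v₂ + 4 * v₁
        ≡⟨ cong (_+ 4 * v₁) (sym e₂) ⟩
      inversions h rot + inversions rot (h ∘ rot) + 4 * v₁
        ≡⟨ cong (λ t → inversions h rot + t + 4 * v₁)
             (trans (inversions-∘ (λ x → x) h rot-inj) (trans (inversions-sym (λ x → x) h) ew)) ⟩
      inversions h rot + 2 * w + 4 * v₁
        ≡⟨ swap (inversions h rot) (2 * w) (4 * v₁) ⟩
      inversions h rot + 4 * v₁ + 2 * w
        ≡⟨ cong (_+ 2 * w) (trans (sym e₁) (cong₂ _+_ ew (inversions-rot n))) ⟩
      2 * w + 2 * n + 2 * w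
        ≡⟨ collect n w ⟩
      2 * n + 4 * w ∎)

  module _ {n : ℕ} {f : Fin (suc n) → Fin (suc n)} (f-inj : Inj f)
           (reach : ∀ b → ∃ λ q → iter f q b ≡ zero) where

    orbit : Fin (suc n) → Fin (suc n)
    orbit i = iter f (toℕ i) zero

    orbit-onto : Onto orbit
    orbit-onto b with reach b
    ... | q , e with reach-back f-inj q e
    ...   | r , e′ = fromℕ< r<  , trans (cong (λ k → iter f k zero) (toℕ-fromℕ< r<)) (trans (sym (iter-% f-inj zero r)) e′)
      where
      r< : r % period f-inj zero < suc n
      r< = <-≤-trans (m%n<n r (period f-inj zero)) (proj₁ (proj₂ (return f-inj zero)))

    orbit-inj : Inj orbit
    orbit-inj = onto⇒inj orbit-onto

    orbit-rot : ∀ i → f (orbit (rot i)) ≡ orbit i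
    orbit-rot (suc i) = cong (λ k → f (iter f k zero)) (toℕ-inject₁ i)
    orbit-rot zero with orbit-onto (f (orbit (fromℕ n)))
    ... | zero  , e = sym e
    ... | suc k , e = ⊥-elim (fromℕ≢inject₁ {i = k} (orbit-inj (f-inj
            (trans (sym e) (cong (λ k → f (iter f k zero)) (sym (toℕ-inject₁ k)))))))

    -- Numbering the points along the cycle by `orbit` conjugates `f` to the inverse of `rot`.
    -- Reindexing by `orbit ∘ rot` therefore turns `g` into `h ∘ orbit` and `h` into
    -- `h ∘ orbit ∘ rot`.
    inversions-of-cycle : ∀ {g h : Fin (suc n) → Fin (suc n)} → Inj h → (∀ z → g z ≡ h (f z)) →
      ∃ λ a → ∃ λ b → inversions g h + 4 * a ≡ 2 * n + 4 * b
    inversions-of-cycle {g} {h} h-inj e = transfer (inversions-∘rot {h = h ∘ orbit} (λ q → orbit-inj (h-inj q)))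
      where
      same : inversions g h ≡ inversions (h ∘ orbit) (h ∘ orbit ∘ rot)
      same = trans (sym (inversions-∘ g h {orbit ∘ rot} (λ q → rot-inj (orbit-inj q))))
        (inversions-cong {g = h ∘ orbit ∘ rot} {g′ = h ∘ orbit ∘ rot} (λ i → trans (e (orbit (rot i))) (cong h (orbit-rot i))) (λ i → refl))
      transfer : (∃ λ a → ∃ λ b → inversions (h ∘ orbit) (h ∘ orbit ∘ rot) + 4 * a ≡ 2 * n + 4 * b) →
        ∃ λ a → ∃ λ b → inversions g h + 4 * a ≡ 2 * n + 4 * b
      transfer (a , b , eq) = a , b , trans (cong (_+ 4 * a) same) eq

  nonzero : ∀ {n} (z : Fin (suc n)) → z ≢ zero → ∃ λ u → z ≡ suc u
  nonzero zero    z≢0 = ⊥-elim (z≢0 refl)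
  nonzero (suc u) _   = u , refl

  -- Colour classes of a supposed acyclic colouring with n + 1 colours.

  module TooFewColours (n : ℕ) (c : Fin n → Fin n → Fin (suc n))
    (row-inj : ∀ {u v v′} → c u v ≡ c u v′ → v ≡ v′)
    (col-inj : ∀ {u u′ v} → c u v ≡ c u′ v → u ≡ u′)
    (no-alternating : ∀ {a b} → a ≢ b → (u v : ℕ → Fin n) →
       (∀ q → c (u q) (v q) ≡ a) → (∀ q → c (u (suc q)) (v q) ≡ b) → ⊥)
    where

    Has : Fin n → Fin (suc n) → Set
    Has u X = ∃ λ v → c u v ≡ X

    has? : ∀ u X → Dec (Has u X)
    has? u X = any? (λ v → c u v ≟ X)

    -- The `n` edges at `u` have distinct colours, all different from `X`, so they use up the other
    -- `n` colours, `Y` included.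
    missing-unique : ∀ {u X Y} → ¬ Has u X → ¬ Has u Y → X ≡ Y
    missing-unique {u} {X} {Y} ¬X ¬Y with X ≟ Y
    ... | yes e = e
    ... | no X≢Y with inj⇒onto {f = λ v → punchOut (λ e → ¬X (v , sym e))}
                       (λ {v} {v′} e → row-inj (punchOut-injective (λ e → ¬X (v , sym e)) (λ e → ¬X (v′ , sym e)) e)) (punchOut X≢Y)
    ...   | v , e = ⊥-elim (¬Y (v , punchOut-injective (λ e → ¬X (v , sym e)) X≢Y e))

    missing : ∀ u → ∃ λ X → ¬ Has u X
    missing u with missed-value (c u) (n<1+n n)
    ... | X , h = X , λ { (v , e) → h v e }

    miss : Fin n → Fin (suc n)
    miss u = proj₁ (missing u)

    -- Each of the `n` left vertices misses a single colour, so one of the n + 1 colours is missed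
    -- by none of them.
    M : Fin (suc n)
    M = proj₁ (missed-value miss (n<1+n n))

    has-unless-missed : ∀ {X} → (∀ u → miss u ≢ X) → ∀ u → Has u X
    has-unless-missed {X} h u with has? u X
    ... | yes q = q
    ... | no ¬q = ⊥-elim (h u (missing-unique (proj₂ (missing u)) ¬q))

    has-M : ∀ u → Has u M
    has-M = has-unless-missed (proj₂ (missed-value miss (n<1+n n)))

    -- Going along `X` and back along `Y` never gets stuck, so an alternating walk exists.
    two-perfect : ∀ {X Y} → X ≢ Y → (∀ u → Has u X) → (∀ u → Has u Y) → Fin n → ⊥
    two-perfect {X} {Y} X≢Y hX hY o = no-alternating X≢Y us (λ q → proj₁ (hX (us q)))
      (λ q → proj₂ (hX (us q))) (λ q → subst (λ v → c (us (suc q)) v ≡ Y) (proj₂ (back (us q))) (proj₂ (hY (us (suc q)))))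
      where
      back : ∀ u → ∃ λ u′ → proj₁ (hY u′) ≡ proj₁ (hX u)
      back u = inj⇒onto {f = λ u → proj₁ (hY u)}
        (λ {u} {u′} e → col-inj (trans (proj₂ (hY u)) (trans (sym (proj₂ (hY u′))) (cong (c u′) (sym e))))) (proj₁ (hX u))
      us : ℕ → Fin n
      us zero    = o
      us (suc q) = proj₁ (back (us q))

    miss≢M : ∀ u → M ≢ miss u
    miss≢M u e = proj₂ (missing u) (subst (Has u) e (has-M u))

    -- A colour other than `M` missed by no vertex would be a second perfect matching. So `miss`
    -- covers all `n` colours other than `M`, and a surjection between sets of size `n` is
    -- injective.
    miss-inj : ∀ {u u′} → miss u ≡ miss u′ → u ≡ u′
    miss-inj {u} {u′} e = onto⇒inj onto (punchOut-cong M {i≢j = miss≢M u} {miss≢M u′} e)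
      where
      onto : Onto (λ u → punchOut (miss≢M u))
      onto y with any? (λ u → punchOut (miss≢M u) ≟ y)
      ... | yes q = q
      ... | no ¬q = ⊥-elim (two-perfect (λ e → punchInᵢ≢i M y (sym e)) has-M
              (has-unless-missed {punchIn M y} λ u e → ¬q (u , trans (punchOut-cong M e) (punchOut-punchIn M))) u)

    unique-missing : ∀ {u u′ X} → ¬ Has u X → ¬ Has u′ X → u ≡ u′
    unique-missing {u} {u′} h h′ = miss-inj (trans (missing-unique (proj₂ (missing u)) h) (sym (missing-unique (proj₂ (missing u′)) h′)))

    -- A colour class, completed to a permutation by a new vertex zero on each side.
    partner : Fin (suc n) → Fin n → Fin (suc n)
    partner X u with has? u X
    ... | yes (v , _) = suc v
    ... | no  _       = zero

    partner-suc : ∀ {X u v} → partner X u ≡ suc v → c u v ≡ X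
    partner-suc {X} {u} e with has? u X
    partner-suc refl | yes (v , q) = q

    partner-zero : ∀ {X u} → partner X u ≡ zero → ¬ Has u X
    partner-zero {X} {u} e with has? u X
    partner-zero () | yes _
    ... | no ¬q = ¬q

    partner-has : ∀ {X u v} → c u v ≡ X → partner X u ≡ suc v
    partner-has {X} {u} {v} e with has? u X
    ... | yes (v′ , e′) = cong suc (row-inj (trans e′ (sym e)))
    ... | no ¬q = ⊥-elim (¬q (v , e))

    partner-none : ∀ {X u} → ¬ Has u X → partner X u ≡ zero
    partner-none {X} {u} h with has? u X
    ... | yes q = ⊥-elim (h q)
    ... | no _  = refl

    partner-inj : ∀ X → Inj (partner X)
    partner-inj X {u} {u′} e = lemma (partner X u′) e refl
      where
      lemma : ∀ z → partner X u ≡ z → partner X u′ ≡ z → u ≡ u′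
      lemma zero    p q = unique-missing (partner-zero p) (partner-zero q)
      lemma (suc v) p q = col-inj (trans (partner-suc p) (sym (partner-suc q)))

    hat : Fin (suc n) → Fin (suc n) → Fin (suc n)
    hat X zero    = proj₁ (missed-value (partner X) (n<1+n n))
    hat X (suc u) = partner X u

    hat-inj : ∀ X → Inj (hat X)
    hat-inj X {zero}  {zero}   e = refl
    hat-inj X {zero}  {suc u}  e = ⊥-elim (proj₂ (missed-value (partner X) (n<1+n n)) u (sym e))
    hat-inj X {suc u} {zero}   e = ⊥-elim (proj₂ (missed-value (partner X) (n<1+n n)) u e)
    hat-inj X {suc u} {suc u′} e = cong suc (partner-inj X e)

    -- The quotient of `hat X` by `hat Y`: from a left vertex along `X`, then back along `Y`.
    next : Fin (suc n) → Fin (suc n) → Fin (suc n) → Fin (suc n)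
    next X Y z = proj₁ (inj⇒onto (hat-inj Y) (hat X z))

    hat-next : ∀ X Y z → hat Y (next X Y z) ≡ hat X z
    hat-next X Y z = proj₂ (inj⇒onto (hat-inj Y) (hat X z))

    next-inj : ∀ X Y → Inj (next X Y)
    next-inj X Y {z} {z′} e = hat-inj X (trans (sym (hat-next X Y z)) (trans (cong (hat Y) e) (hat-next X Y z′)))

    next-≡ : ∀ X Y z z′ → hat X z ≡ hat Y z′ → next X Y z ≡ z′
    next-≡ X Y z z′ e = hat-inj Y (trans (hat-next X Y z) e)

    -- An orbit that meets the new vertex on neither side uses genuine edges only, hence is an
    -- alternating walk.
    avoids-zero : ∀ {X Y} → X ≢ Y → ∀ b → (∀ q → iter (next X Y) q b ≢ zero) →
      (∀ q → hat X (iter (next X Y) q b) ≢ zero) → ⊥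
    avoids-zero {X} {Y} X≢Y b z≢ h≢ = no-alternating X≢Y us vs
      (λ q → partner-suc (trans (cong (hat X) (sym (eu q))) (ev q)))
      (λ q → partner-suc (trans (cong (hat Y) (sym (eu (suc q)))) (trans (hat-next X Y (iter (next X Y) q b)) (ev q))))
      where
      us vs : ℕ → Fin n
      us q = proj₁ (nonzero _ (z≢ q))
      vs q = proj₁ (nonzero _ (h≢ q))
      eu : ∀ q → iter (next X Y) q b ≡ suc (us q)
      eu q = proj₂ (nonzero _ (z≢ q))
      ev : ∀ q → hat X (iter (next X Y) q b) ≡ suc (vs q)
      ev q = proj₂ (nonzero _ (h≢ q))

    hat-M-zero : hat M zero ≡ zero
    hat-M-zero with inj⇒onto (hat-inj M) zero
    ... | zero  , e = e
    ... | suc u , e = ⊥-elim (partner-zero e (has-M u))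

    -- `M` matches the two new vertices with each other, so an orbit meeting either of them passes
    -- through zero. All orbits do, which makes `next X M` a single cycle.
    reach-M : ∀ {X} → X ≢ M → ∀ b → ∃ λ q → iter (next X M) q b ≡ zero
    reach-M {X} X≢M b = reach? (next-inj X M) b zero λ z≢ →
      avoids-zero X≢M b z≢ (λ q e → z≢ (suc q) (next-≡ X M (iter (next X M) q b) zero (trans e (sym hat-M-zero))))

    contradiction : ∀ {o o′ : Fin n} → o ≢ o′ → ∀ m → n ≡ suc (m + m) → ⊥
    contradiction {o} {o′} o≢o′ m n≡ = finish
      (inversions-of-cycle (next-inj A M) (reach-M A≢M) (hat-inj M) (λ z → sym (hat-next A M z)))
      (inversions-of-cycle (next-inj C M) (reach-M C≢M) (hat-inj M) (λ z → sym (hat-next C M z)))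
      (inversions-of-cycle (next-inj C A) reach-A (hat-inj A) (λ z → sym (hat-next C A z)))
      (inversions-triangle (hat-inj C) (hat-inj A) (hat-inj M))
      where
      A : Fin (suc n)
      A = miss o
      A≢M : A ≢ M
      A≢M e = miss≢M o (sym e)
      hat-A-o : hat A (suc o) ≡ zero
      hat-A-o = partner-none (proj₂ (missing o))
      vA : ∃ λ v → hat A zero ≡ suc v
      vA = nonzero _ λ e → lemma (hat-inj A {zero} {suc o} (trans e (sym hat-A-o)))
        where
        lemma : zero ≢ suc o
        lemma ()
      C : Fin (suc n)
      C = c o (proj₁ vA)
      C≢A : C ≢ A
      C≢A e = proj₂ (missing o) (proj₁ vA , e)
      hat-C-o : hat C (suc o) ≡ hat A zero
      hat-C-o = trans (partner-has refl) (sym (proj₂ vA))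
      -- If `C` were `M`, then zero and `suc o` would form an orbit of length two of `next A M`, and
      -- `suc o′` would lie outside it.
      C≢M : C ≢ M
      C≢M e with reach-M A≢M (suc o′)
      ... | q , eq with reach-back (next-inj A M) q eq
      ...   | r , er = two (trapped r)
        where
        trapped : ∀ r → iter (next A M) r zero ≡ zero ⊎ iter (next A M) r zero ≡ suc o
        trapped zero    = inj₁ refl
        trapped (suc r) with trapped r
        ... | inj₁ p = inj₂ (trans (cong (next A M) p) (next-≡ A M zero (suc o) (trans (sym hat-C-o) (cong (λ X → hat X (suc o)) e))))
        ... | inj₂ p = inj₁ (trans (cong (next A M) p) (next-≡ A M (suc o) zero (trans hat-A-o (sym hat-M-zero))))
        two : iter (next A M) r zero ≡ zero ⊎ iter (next A M) r zero ≡ suc o → ⊥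
        two (inj₁ p) with trans (sym er) p
        ... | ()
        two (inj₂ p) = o≢o′ (suc-injective (trans (sym p) er))
      -- An orbit that runs along `C` into the new right vertex returns along `A` to `suc o`; the
      -- edge of colour `C` at `o` then leads on to zero, hence the two extra steps.
      reach-A : ∀ b → ∃ λ q → iter (next C A) q b ≡ zero
      reach-A b = reach? (next-inj C A) b zero λ z≢ →
        avoids-zero C≢A b z≢ λ q e → z≢ (suc (suc q))
          (trans (cong (next C A) (next-≡ C A (iter (next C A) q b) (suc o) (trans e (sym hat-A-o)))) (next-≡ C A (suc o) zero hat-C-o))
      finish : (∃ λ a → ∃ λ b → inversions (hat A) (hat M) + 4 * a ≡ 2 * n + 4 * b) →
               (∃ λ a → ∃ λ b → inversions (hat C) (hat M) + 4 * a ≡ 2 * n + 4 * b) →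
               (∃ λ a → ∃ λ b → inversions (hat C) (hat A) + 4 * a ≡ 2 * n + 4 * b) →
               (∃ λ v → inversions (hat C) (hat A) + inversions (hat A) (hat M) ≡ inversions (hat C) (hat M) + 4 * v) → ⊥
      -- Modulo 4 the triangle says 2n + 2n = 2n, so n would be even; cancelling 2n and a factor 2
      -- leaves an even number equal to an odd one.
      finish (a₁ , b₁ , e₁) (a₂ , b₂ , e₂) (a₃ , b₃ , e₃) (v , e) =
        even≢odd (b₂ + v + a₁ + a₃) (b₁ + b₃ + a₂ + m) (*-cancelˡ-≡ _ _ 2 (+-cancelˡ-≡ (2 * n) _ _ (begin
          2 * n + 2 * (2 * (b₂ + v + a₁ + a₃))
            ≡⟨ r₁ n b₂ (v + a₁ + a₃) v a₁ a₃ ⟩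
          2 * n + 4 * b₂ + 4 * (v + a₁ + a₃)
            ≡⟨ cong (_+ 4 * (v + a₁ + a₃)) (sym e₂) ⟩
          inversions (hat C) (hat M) + 4 * a₂ + 4 * (v + a₁ + a₃)
            ≡⟨ r₂ (inversions (hat C) (hat M)) a₂ v a₁ a₃ ⟩
          inversions (hat C) (hat M) + 4 * v + 4 * (a₂ + a₁ + a₃)
            ≡⟨ cong (_+ 4 * (a₂ + a₁ + a₃)) (sym e) ⟩
          inversions (hat C) (hat A) + inversions (hat A) (hat M) + 4 * (a₂ + a₁ + a₃)
            ≡⟨ r₃ (inversions (hat C) (hat A)) (inversions (hat A) (hat M)) a₁ a₂ a₃ ⟩
          (inversions (hat C) (hat A) + 4 * a₃) + (inversions (hat A) (hat M) + 4 * a₁) + 4 * a₂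
            ≡⟨ cong₂ (λ s t → s + t + 4 * a₂) e₃ e₁ ⟩
          (2 * n + 4 * b₃) + (2 * n + 4 * b₁) + 4 * a₂
            ≡⟨ cong (λ k → (2 * n + 4 * b₃) + (2 * k + 4 * b₁) + 4 * a₂) n≡ ⟩
          (2 * n + 4 * b₃) + (2 * suc (m + m) + 4 * b₁) + 4 * a₂
            ≡⟨ r₄ n m b₁ b₃ a₂ ⟩
          2 * n + 2 * suc (2 * (b₁ + b₃ + a₂ + m)) ∎)))
        where
        open ≡-Reasoning
        r₁ : ∀ n b s v a a′ → 2 * n + 2 * (2 * (b + v + a + a′)) ≡ 2 * n + 4 * b + 4 * (v + a + a′)
        r₁ = solve-∀
        r₂ : ∀ t a₂ v a₁ a₃ → t + 4 * a₂ + 4 * (v + a₁ + a₃) ≡ t + 4 * v + 4 * (a₂ + a₁ + a₃)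
        r₂ = solve-∀
        r₃ : ∀ s t a₁ a₂ a₃ → s + t + 4 * (a₂ + a₁ + a₃) ≡ (s + 4 * a₃) + (t + 4 * a₁) + 4 * a₂
        r₃ = solve-∀
        r₄ : ∀ n m b₁ b₃ a₂ → (2 * n + 4 * b₃) + (2 * suc (m + m) + 4 * b₁) + 4 * a₂ ≡ 2 * n + 2 * suc (2 * (b₁ + b₃ + a₂ + m))
        r₄ = solve-∀

-- Alternating walks in the complete bipartite graph and the lower bound.

module Lower where

  open import Defs hiding (sym; n; inj; x; r)
  open Injections
  open TooFew
  open import Data.Nat using (ℕ; zero; suc; _+_; _∸_; _≤_; _<_; s≤s)
  open import Data.Nat.Properties using (+-suc; +-comm; ≤-trans; <⇒≤; n<1+n; m∸n+n≡m; <-cmp; m<n⇒0<n∸m; m∸n≤m; ≤-pred; <⇒≱; m≤m+n; +-mono-≤; ≰⇒>; ≤⇒≯; _≤?_)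
  open import Data.Fin using (Fin; zero; suc; toℕ; inject≤; _↑ˡ_; _↑ʳ_)
  open import Data.Fin.Properties using (pigeonhole; toℕ<n; toℕ-injective; toℕ-fromℕ; toℕ-inject₁; toℕ-↑ˡ; toℕ-↑ʳ; ↑ˡ-injective; ↑ʳ-injective; inject≤-injective) renaming (_≟_ to _≟ᶠ_)
  open import Relation.Binary using (tri<; tri≈; tri>)
  open import Function using (_∘_)

  module _ {n : ℕ} where

    left right : Fin n → Fin (n + n)
    left u  = u ↑ˡ n
    right v = n ↑ʳ v

    left< : ∀ u → toℕ (left u) < n
    left< u = subst (_< n) (sym (toℕ-↑ˡ u n)) (toℕ<n u)

    right≥ : ∀ v → n ≤ toℕ (right v)
    right≥ v = subst (n ≤_) (sym (toℕ-↑ʳ n v)) (m≤m+n n (toℕ v))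

    edge : ∀ u v → Adj (K n) (left u) (right v)
    edge u v = inj₁ (left< u , right≥ v)

    edge⁻ : ∀ v u → Adj (K n) (right v) (left u)
    edge⁻ v u = inj₂ (right≥ v , left< u)

    left≢right : ∀ {u v} → left u ≢ right v
    left≢right {u} {v} e = <⇒≱ (subst (_< n) (cong toℕ e) (left< u)) (right≥ v)

    zigzag : (u v : ℕ → Fin n) → ℕ → Fin (n + n)
    zigzag u v zero          = left (u 0)
    zigzag u v (suc zero)    = right (v 0)
    zigzag u v (suc (suc k)) = zigzag (u ∘ suc) (v ∘ suc) k

    zigzag-adj : ∀ u v k → Adj (K n) (zigzag u v k) (zigzag u v (suc k))
    zigzag-adj u v zero          = edge (u 0) (v 0)
    zigzag-adj u v (suc zero)    = edge⁻ (v 0) (u 1)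
    zigzag-adj u v (suc (suc k)) = zigzag-adj (u ∘ suc) (v ∘ suc) k

    zigzag-even : ∀ u v q → zigzag u v (q + q) ≡ left (u q)
    zigzag-even u v zero    = refl
    zigzag-even u v (suc q) rewrite +-suc q q = zigzag-even (u ∘ suc) (v ∘ suc) q

    Position : (u v : ℕ → Fin n) → ℕ → Set
    Position u v k = ∃ λ q → (k ≡ q + q × zigzag u v k ≡ left (u q)) ⊎ (k ≡ suc (q + q) × zigzag u v k ≡ right (v q))

    position : ∀ u v k → Position u v k
    position u v zero          = 0 , inj₁ (refl , refl)
    position u v (suc zero)    = 0 , inj₂ (refl , refl)
    position u v (suc (suc k)) with position (u ∘ suc) (v ∘ suc) k
    ... | q , inj₁ (e , e′) = suc q , inj₁ (trans (cong (2 +_) e) (cong suc (sym (+-suc q q))) , e′)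
    ... | q , inj₂ (e , e′) = suc q , inj₂ (trans (cong (2 +_) e) (cong (2 +_) (sym (+-suc q q))) , e′)

    half< : ∀ {q m} → q + q < m + m → q < m
    half< {q} {m} h with suc q ≤? m
    ... | yes q<m = q<m
    ... | no q≮m with ≰⇒> q≮m
    ...   | s≤s m≤q = ⊥-elim (≤⇒≯ (+-mono-≤ m≤q m≤q) h)

    module _ {k : ℕ} (c : EdgeColoring (K n) k) (acyclic : Acyclic c) where

      colour : Fin n → Fin n → Fin k
      colour u v = col c (edge u v)

      colour-row : ∀ {u v v′} → colour u v ≡ colour u v′ → v ≡ v′
      colour-row e = ↑ʳ-injective n _ _ (proj₁ acyclic (edge _ _) (edge _ _) e)

      colour-col : ∀ {u u′ v} → colour u v ≡ colour u′ v → u ≡ u′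
      colour-col {u} {u′} {v} e = ↑ˡ-injective n _ _ (proj₁ acyclic (edge⁻ v u) (edge⁻ v u′)
        (trans (colSym c (edge u v)) (trans e (sym (colSym c (edge u′ v))))))

      module _ {a b : Fin k} (a≢b : a ≢ b) (u v : ℕ → Fin n)
               (ha : ∀ q → colour (u q) (v q) ≡ a) (hb : ∀ q → colour (u (suc q)) (v q) ≡ b) where

        u-back : ∀ {i j} → u (suc i) ≡ u (suc j) → u i ≡ u j
        u-back {i} {j} e = colour-col (trans (ha i) (trans (sym (ha j)) (cong (colour (u j)) (sym v≡))))
          where
          v≡ : v i ≡ v j
          v≡ = colour-row (trans (hb i) (trans (sym (hb j)) (cong (λ w → colour w (v j)) (sym e))))

        -- In a proper colouring each vertex of the walk determines its predecessor, so the walk is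
        -- purely periodic and any repetition can be shifted back to the start.
        u-cancel : ∀ i j → u i ≡ u (j + i) → u 0 ≡ u j
        u-cancel zero    j e = trans e (cong u (+-comm j 0))
        u-cancel (suc i) j e = u-cancel i j (u-back (trans e (cong u (+-suc j i))))

        u-distinct : ∀ {m} → (∀ j → j < m → u (suc j) ≢ u 0) → ∀ {i j} → i < j → j ≤ m → u i ≢ u j
        u-distinct {m} min {i} {j} i<j j≤m e = lemma (j ∸ i) refl (m<n⇒0<n∸m i<j)
          where
          lemma : ∀ d → j ∸ i ≡ d → 0 < d → ⊥
          lemma (suc d) eq _ = min d (≤-trans (subst (_≤ j) eq (m∸n≤m j i)) j≤m)
            (sym (u-cancel i (suc d) (trans e (cong u (trans (sym (m∸n+n≡m (<⇒≤ i<j))) (cong (_+ i) eq))))))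

        first-return : ∃ λ m → u (suc m) ≡ u 0 × (∀ j → j < m → u (suc j) ≢ u 0)
        first-return with pigeonhole (n<1+n n) (λ i → u (toℕ i))
        ... | i , j , i<j , e = lemma (toℕ j ∸ toℕ i) refl (m<n⇒0<n∸m i<j)
          where
          lemma : ∀ d → toℕ j ∸ toℕ i ≡ d → 0 < d → ∃ λ m → u (suc m) ≡ u 0 × (∀ j → j < m → u (suc j) ≢ u 0)
          lemma (suc d) eq _ with least (λ k → u (suc k) ≡ u 0) (λ k → u (suc k) ≟ᶠ u 0) d
            (sym (u-cancel (toℕ i) (suc d) (trans e (cong u (trans (sym (m∸n+n≡m (<⇒≤ i<j))) (cong (_+ toℕ i) eq))))))
          ... | m , _ , em , min = m , em , min

        u-inj : ∀ {m} → (∀ j → j < m → u (suc j) ≢ u 0) → ∀ {i j} → i < suc m → j < suc m → u i ≡ u j → i ≡ j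
        u-inj min {i} {j} (s≤s i≤m) (s≤s j≤m) e with <-cmp i j
        ... | tri< i<j _ _ = ⊥-elim (u-distinct min i<j j≤m e)
        ... | tri≈ _ i≡j _ = i≡j
        ... | tri> _ _ j<i = ⊥-elim (u-distinct min j<i i≤m (sym e))

        zigzag-col : ∀ k (e : Adj (K n) (zigzag u v k) (zigzag u v (suc k))) → col c e ≡ a ⊎ col c e ≡ b
        zigzag-col k e = subst (λ e → col c e ≡ a ⊎ col c e ≡ b) (unique (K n) (zigzag-adj u v k) e) (lemma u v ha hb k)
          where
          lemma : ∀ u v → (∀ q → colour (u q) (v q) ≡ a) → (∀ q → colour (u (suc q)) (v q) ≡ b) →
            ∀ k → col c (zigzag-adj u v k) ≡ a ⊎ col c (zigzag-adj u v k) ≡ b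
          lemma u v ha hb zero          = inj₁ (ha 0)
          lemma u v ha hb (suc zero)    = inj₂ (trans (colSym c (edge (u 1) (v 0))) (hb 0))
          lemma u v ha hb (suc (suc k)) = lemma (u ∘ suc) (v ∘ suc) (ha ∘ suc) (hb ∘ suc) k

        zigzag-col′ : ∀ {k k′ z} → k ≡ k′ → zigzag u v (suc k) ≡ z →
          (e : Adj (K n) (zigzag u v k′) z) → col c e ≡ a ⊎ col c e ≡ b
        zigzag-col′ {k} refl refl = zigzag-col k

        alternating-⊥ : ⊥
        alternating-⊥ with first-return
        -- A return after one round would give the edge from `u 0` to `v 0` both colours.
        ... | zero , e , _ = a≢b (trans (sym (ha 0)) (trans (cong (λ w → colour w (v 0)) (sym e)) (hb 0)))
        ... | suc m , e , min = proj₂ acyclic cycle (a , b , (λ i → zigzag-col′ (sym (toℕ-inject₁ i)) refl (step cycle i)) ,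
                                  zigzag-col′ (sym (toℕ-fromℕ (suc (suc (suc (m + m)))))) return₀ (close cycle))
          where
          len : suc (suc (suc (suc (m + m)))) ≡ suc (suc m) + suc (suc m)
          len = cong (2 +_) (trans (cong suc (sym (+-suc m m))) (sym (+-suc m (suc m))))
          return₀ : zigzag u v (suc (suc (suc (suc (m + m))))) ≡ zigzag u v 0
          return₀ = trans (cong (zigzag u v) len) (trans (zigzag-even u v (suc (suc m))) (cong left e))
          zigzag-inj : ∀ {i j} → i < suc (suc (suc (suc (m + m)))) → j < suc (suc (suc (suc (m + m)))) →
            zigzag u v i ≡ zigzag u v j → i ≡ j
          zigzag-inj {i} {j} i< j< eq with position u v i | position u v j
          ... | q , inj₁ (refl , x) | q′ , inj₁ (refl , y) =
            cong (λ q → q + q) (u-inj min (half< (subst (q + q <_) len i<)) (half< (subst (q′ + q′ <_) len j<))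
              (↑ˡ-injective n _ _ (trans (sym x) (trans eq y))))
          ... | q , inj₁ (refl , x) | q′ , inj₂ (refl , y) = ⊥-elim (left≢right (trans (sym x) (trans eq y)))
          ... | q , inj₂ (refl , x) | q′ , inj₁ (refl , y) = ⊥-elim (left≢right (trans (sym y) (trans (sym eq) x)))
          ... | q , inj₂ (refl , x) | q′ , inj₂ (refl , y) =
            cong (λ q → suc (q + q)) (u-inj min (half< (subst (q + q <_) len (<⇒≤ i<))) (half< (subst (q′ + q′ <_) len (<⇒≤ j<)))
              (colour-col (trans (ha q) (trans (sym (ha q′)) (cong (colour (u q′)) (sym (↑ʳ-injective n _ _ (trans (sym x) (trans eq y)))))))))
          cycle : Cycle (K n)
          cycle = record
            -- The walk closes after m + 2 rounds, that is 2m + 4 vertices, and a `Cycle` has r + 3.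
            { r     = suc (m + m)
            ; x     = λ i → zigzag u v (toℕ i)
            ; inj   = λ {i} {j} eq → toℕ-injective (zigzag-inj (toℕ<n i) (toℕ<n j) eq)
            ; step  = λ i → subst (λ k → Adj (K n) (zigzag u v k) (zigzag u v (suc (toℕ i)))) (sym (toℕ-inject₁ i)) (zigzag-adj u v (toℕ i))
            ; close = subst₂ (Adj (K n)) (cong (zigzag u v) (sym (toℕ-fromℕ (suc (suc (suc (m + m))))))) return₀ (zigzag-adj u v (suc (suc (suc (m + m)))))
            }

    lower-bound : ∀ m → n ≡ suc (m + m) → 1 < n → ∀ j → j < n + 2 → ¬ AcyclicColorable (K n) j
    lower-bound m n≡ 1<n j j<n+2 (c , acyclic) = TooFewColours.contradiction n
      (λ u v → embed (colour c acyclic u v))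
      (λ e → colour-row c acyclic (embed-inj e))
      (λ e → colour-col c acyclic (embed-inj e))
      -- `a` and `b` live in the enlarged palette, so the colours of the walk are read off its first
      -- two edges to get preimages under `embed`.
      (λ {a} a≢b u v ha hb → alternating-⊥ c acyclic {colour c acyclic (u 0) (v 0)} {colour c acyclic (u 1) (v 0)}
         (λ e → a≢b (trans (sym (ha 0)) (trans (cong embed e) (hb 0)))) u v
         (λ q → embed-inj (trans (ha q) (sym (ha 0)))) (λ q → embed-inj (trans (hb q) (sym (hb 0)))))
      {o n 1<n} {o′ n 1<n} (o≢o′ n 1<n) m n≡
      where
      j≤ : j ≤ suc n
      j≤ = ≤-pred (subst (suc j ≤_) (+-comm n 2) j<n+2)
      embed : Fin j → Fin (suc n)
      embed x = inject≤ x j≤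
      embed-inj : ∀ {x y} → embed x ≡ embed y → x ≡ y
      embed-inj {x} {y} = inject≤-injective j≤ j≤ x y
      o o′ : ∀ n → 1 < n → Fin n
      o  (suc n) _ = zero
      o′ (suc (suc n)) _ = suc zero
      o′ (suc zero) (s≤s ())
      o≢o′ : ∀ n 1<n → o n 1<n ≢ o′ n 1<n
      o≢o′ (suc (suc n)) _ ()
      o≢o′ (suc zero) (s≤s ())

-- From bichromatic cycles to closed vertex sets.

module ClosedSets where

  open import Defs hiding (sym; n; inj; x; r)
  open Lower
  open import Data.Nat using (ℕ; zero; suc; _+_; _≤_)
  open import Data.Nat.Properties using (<⇒≱; suc-injective)
  open import Data.Fin using (Fin; zero; suc; toℕ; fromℕ; inject₁; fromℕ<; reduce≥; _↑ʳ_; splitAt)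
  open import Data.Fin.Properties using (toℕ-injective; toℕ-fromℕ<; toℕ-↑ˡ; toℕ-inject₁; join-splitAt; ↑ʳ-injective)

  -- The vertex set of a bichromatic cycle, with its cyclic order forgotten.
  record Closed {V C : Set} (c : V → V → C) (a b : C) : Set₁ where
    field
      L R       : V → Set
      inhabited : ∃ L
      L-next    : ∀ {u} → L u → ∀ z → z ≡ a ⊎ z ≡ b → ∃ λ v → R v × c u v ≡ z
      R-next    : ∀ {v} → R v → ∀ z → z ≡ a ⊎ z ≡ b → ∃ λ u → L u × c u v ≡ z

  module _ {n : ℕ} {V C : Set} (c : V → V → C)
    (c-row : ∀ {u v v′} → c u v ≡ c u v′ → v ≡ v′)
    (c-col : ∀ {u u′ v} → c u v ≡ c u′ v → u ≡ u′)
    (no-closed : ∀ {a b} → a ≢ b → ¬ Closed c a b)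
    {k : ℕ} (vertex : Fin n → V) (vertex-inj : ∀ {u v} → vertex u ≡ vertex v → u ≡ v)
    (encode : C → Fin k) (encode-inj : ∀ {a b} → encode a ≡ encode b → a ≡ b)
    where

    between : Fin n → Fin n → Fin k
    between u v = encode (c (vertex u) (vertex v))

    colouring : EdgeColoring (K n) k
    colouring = record { col = colour′ ; colSym = symmetric }
      where
      colour′ : ∀ {u v} → Adj (K n) u v → Fin k
      colour′ {u} {v} (inj₁ (u<n , n≤v)) = between (fromℕ< u<n) (reduce≥ v n≤v)
      colour′ {u} {v} (inj₂ (n≤u , v<n)) = between (fromℕ< v<n) (reduce≥ u n≤u)
      symmetric : ∀ {u v} (e : Adj (K n) u v) → colour′ (Graph.sym (K n) e) ≡ colour′ e
      symmetric (inj₁ _) = refl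
      symmetric (inj₂ _) = refl

    ↑ʳ-reduce≥ : ∀ m {n} (i : Fin (m + n)) .(h : m ≤ toℕ i) → m ↑ʳ reduce≥ i h ≡ i
    ↑ʳ-reduce≥ zero    i       h = refl
    ↑ʳ-reduce≥ (suc m) (suc i) h = cong suc (↑ʳ-reduce≥ m i _)

    left-edge : ∀ {u w} (e : Adj (K n) (left u) w) → ∃ λ v → w ≡ right v × col colouring e ≡ between u v
    left-edge {u} {w} (inj₁ (u<n , n≤w)) = reduce≥ w n≤w , sym (↑ʳ-reduce≥ n w n≤w) ,
      cong (λ z → between z (reduce≥ w n≤w)) (toℕ-injective (trans (toℕ-fromℕ< u<n) (toℕ-↑ˡ u n)))
    left-edge {u} (inj₂ (n≤u , _)) = ⊥-elim (<⇒≱ (left< u) n≤u)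

    right-edge : ∀ {v w} (e : Adj (K n) (right v) w) → ∃ λ u → w ≡ left u × col colouring e ≡ between u v
    right-edge {v} (inj₁ (v<n , _)) = ⊥-elim (<⇒≱ v<n (right≥ v))
    right-edge {v} {w} e@(inj₂ (n≤v , w<n)) = fromℕ< w<n ,
      toℕ-injective (sym (trans (toℕ-↑ˡ (fromℕ< w<n) n) (toℕ-fromℕ< w<n))) ,
      cong (between (fromℕ< w<n)) (↑ʳ-injective n (reduce≥ (right v) n≤v) v (↑ʳ-reduce≥ n (right v) n≤v))

    side : ∀ w → (∃ λ u → w ≡ left u) ⊎ (∃ λ v → w ≡ right v)
    side w with splitAt n w | join-splitAt n n w
    ... | inj₁ u | e = inj₁ (u , sym e)
    ... | inj₂ v | e = inj₂ (v , sym e)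

    proper : Proper colouring
    proper {u} {v} {w} e f q with side u
    ... | inj₁ (_ , refl) with left-edge e | left-edge f
    ...   | _ , refl , p | _ , refl , p′ = cong right (vertex-inj (c-row (encode-inj (trans (sym p) (trans q p′)))))
    proper {u} {v} {w} e f q | inj₂ (_ , refl) with right-edge e | right-edge f
    ...   | _ , refl , p | _ , refl , p′ = cong left (vertex-inj (c-col (encode-inj (trans (sym p) (trans q p′)))))

    module _ (cyc : Cycle (K n)) (a b : Fin k)
      (on-step : ∀ i → col colouring (step cyc i) ≡ a ⊎ col colouring (step cyc i) ≡ b)
      (on-close : col colouring (close cyc) ≡ a ⊎ col colouring (close cyc) ≡ b) where

      private
        X : Fin (suc (suc (suc (Cycle.r cyc)))) → Fin (n + n)
        X = Cycle.x cyc

      record Edge (i : Fin (suc (suc (suc (Cycle.r cyc))))) : Set where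
        constructor along
        field
          {end} : Fin (suc (suc (suc (Cycle.r cyc))))
          e     : Adj (K n) (X i) (X end)
          bi    : col colouring e ≡ a ⊎ col colouring e ≡ b

      open Edge

      backwards : ∀ {i j} (e : Adj (K n) (X i) (X j)) → col colouring e ≡ a ⊎ col colouring e ≡ b → Edge j
      backwards e h = along (Graph.sym (K n) e) (Sum.map (trans (colSym colouring e)) (trans (colSym colouring e)) h)

      last-or : ∀ {k} (i : Fin (suc k)) → i ≡ fromℕ k ⊎ ∃ λ j → i ≡ inject₁ j
      last-or {zero}  zero    = inj₁ refl
      last-or {suc k} zero    = inj₂ (zero , refl)
      last-or {suc k} (suc i) = Sum.map (cong suc) (λ { (j , e) → suc j , cong suc e }) (last-or i)

      -- A cycle has at least three vertices, so the predecessor and the successor of a position are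
      -- different.
      two-edges : ∀ i → ∃ λ (e : Edge i) → ∃ λ (f : Edge i) → end e ≢ end f
      two-edges zero = along (step cyc zero) (on-step zero) , backwards (close cyc) on-close , λ ()
      two-edges (suc i) with last-or i
      ... | inj₁ refl = along (close cyc) on-close , backwards (step cyc i) (on-step i) , λ ()
      ... | inj₂ (j , refl) = along (step cyc (suc j)) (on-step (suc j)) , backwards (step cyc i) (on-step i) , different
        where
        different : suc (suc j) ≢ inject₁ (inject₁ j)
        different e with trans (cong toℕ e) (trans (toℕ-inject₁ (inject₁ j)) (toℕ-inject₁ j))
        ... | q = absurd (toℕ j) q
          where
          absurd : ∀ t → suc (suc t) ≢ t
          absurd zero ()
          absurd (suc t) q = absurd t (suc-injective q)

      edges-differ : ∀ {i} (e f : Edge i) → end e ≢ end f → col colouring (Edge.e e) ≢ col colouring (Edge.e f)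
      edges-differ e f e≢f q = e≢f (Cycle.inj cyc (proper (Edge.e e) (Edge.e f) q))

      -- Properness forces different colours on the two cycle edges at a vertex, and only `a` and
      -- `b` are available, so each of them occurs.
      edge-of : ∀ i z → z ≡ a ⊎ z ≡ b → ∃ λ (e : Edge i) → col colouring (Edge.e e) ≡ z
      edge-of i z h with two-edges i
      ... | e , f , e≢f = pick (bi e) (bi f) h
        where
        pick : col colouring (Edge.e e) ≡ a ⊎ col colouring (Edge.e e) ≡ b →
               col colouring (Edge.e f) ≡ a ⊎ col colouring (Edge.e f) ≡ b → z ≡ a ⊎ z ≡ b →
               ∃ λ (e : Edge i) → col colouring (Edge.e e) ≡ z
        pick (inj₁ p) (inj₁ q) _ = ⊥-elim (edges-differ e f e≢f (trans p (sym q)))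
        pick (inj₂ p) (inj₂ q) _ = ⊥-elim (edges-differ e f e≢f (trans p (sym q)))
        pick (inj₁ p) (inj₂ q) (inj₁ refl) = e , p
        pick (inj₁ p) (inj₂ q) (inj₂ refl) = f , q
        pick (inj₂ p) (inj₁ q) (inj₁ refl) = f , q
        pick (inj₂ p) (inj₁ q) (inj₂ refl) = e , p

      a≢b : a ≢ b
      a≢b refl with two-edges zero
      ... | e , f , e≢f = edges-differ e f e≢f (trans (same (bi e)) (sym (same (bi f))))
        where
        same : ∀ {z : Fin k} → z ≡ a ⊎ z ≡ a → z ≡ a
        same (inj₁ q) = q
        same (inj₂ q) = q

      L′ R′ : V → Set
      L′ v = ∃ λ u → vertex u ≡ v × ∃ λ i → X i ≡ left u
      R′ v = ∃ λ u → vertex u ≡ v × ∃ λ i → X i ≡ right u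

      L′-next : ∀ {u} → L′ u → ∀ z → z ≡ a ⊎ z ≡ b → ∃ λ v → R′ v × encode (c u v) ≡ z
      L′-next (u , refl , i , Xi) z h with edge-of i z h
      ... | along {j} e _ , q = along-left Xi e q
        where
        along-left : ∀ {w} → w ≡ left u → (e : Adj (K n) w (X j)) → col colouring e ≡ z → ∃ λ v → R′ v × encode (c (vertex u) v) ≡ z
        along-left refl e q with left-edge e
        ... | v , Xj , r = vertex v , (v , refl , j , Xj) , trans (sym r) q

      R′-next : ∀ {v} → R′ v → ∀ z → z ≡ a ⊎ z ≡ b → ∃ λ u → L′ u × encode (c u v) ≡ z
      R′-next (v , refl , i , Xi) z h with edge-of i z h
      ... | along {j} e _ , q = along-right Xi e q
        where
        along-right : ∀ {w} → w ≡ right v → (e : Adj (K n) w (X j)) → col colouring e ≡ z → ∃ λ u → L′ u × encode (c u (vertex v)) ≡ z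
        along-right refl e q with right-edge e
        ... | u , Xj , r = vertex u , (u , refl , j , Xj) , trans (sym r) q

      some-left : ∃ L′
      some-left with side (X zero)
      ... | inj₁ (u , e) = vertex u , u , refl , zero , e
      ... | inj₂ (v , e) with R′-next (v , refl , zero , e) a (inj₁ refl)
      ...   | u , l , _ = u , l

      not-bichromatic : ⊥
      -- `a` and `b` are arbitrary elements of `Fin k`; the two edges at one left vertex exhibit
      -- them as encodings of colours in `C`.
      not-bichromatic with L′-next (proj₂ some-left) a (inj₁ refl) | L′-next (proj₂ some-left) b (inj₂ refl)
      ... | v , _ , e | w , _ , f = no-closed (λ q → a≢b (trans (sym e) (trans (cong encode q) f))) (record
        { L = L′ ; R = R′ ; inhabited = some-left
        ; L-next = λ l z h → restrict (L′-next l (encode z) (Sum.map (encoded e) (encoded f) h))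
        ; R-next = λ l z h → restrict (R′-next l (encode z) (Sum.map (encoded e) (encoded f) h)) })
        where
        encoded : ∀ {z z′ d} → encode z′ ≡ d → z ≡ z′ → encode z ≡ d
        encoded p refl = p
        restrict : ∀ {P : V → Set} {f : V → C} {z} → (∃ λ v → P v × encode (f v) ≡ encode z) → ∃ λ v → P v × f v ≡ z
        restrict (v , p , q) = v , p , encode-inj q

    colourable : AcyclicColorable (K n) k
    colourable = colouring , proper , λ { cyc (a , b , h , h′) → not-bichromatic cyc a b h h′ }

-- Orbits of x ↦ c - 2x modulo p on a short arc.

module Arcs where

  open import Data.Nat
  open import Data.Nat.Properties
  open import Data.Nat.Tactic.RingSolver using (solve-∀)

  -- The map x ↦ T − 2x doubles the distance ∣3x − T∣, so its only bounded orbit is its fixed point.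
  doubling-fixed : ∀ {h T} (Λ : ℕ → Set) → (∀ {x} → Λ x → x ≤ h) →
    (∀ {x} → Λ x → ∃ λ x′ → Λ x′ × x′ + 2 * x ≡ T) → ∀ {x} → Λ x → 3 * x ≡ T
  doubling-fixed {h} {T} Λ bounded next {x₀} l₀ with ∣ 3 * x₀ - T ∣ in eq
  ... | zero  = ∣m-n∣≡0⇒m≡n eq
  ... | suc _ = ⊥-elim (unbounded (grow (3 * h + T)))
    where
    D : ℕ → ℕ
    D x = ∣ 3 * x - T ∣
    D-next : ∀ {x x′} → x′ + 2 * x ≡ T → D x′ ≡ 2 * D x
    D-next {x} {x′} refl = trans (cong (λ z → ∣ z - x′ + 2 * x ∣) (r₁ x′))
      (trans (∣m+n-m+o∣≡∣n-o∣ x′ (2 * x′) (2 * x))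
      (trans (∣-∣-comm (2 * x′) (2 * x))
      (trans (sym (∣m+n-m+o∣≡∣n-o∣ (4 * x) (2 * x) (2 * x′)))
      (trans (cong₂ ∣_-_∣ (r₂ x) (r₃ x x′)) (sym (*-distribˡ-∣-∣ 2 (3 * x) (x′ + 2 * x)))))))
      where
      r₁ : ∀ x → 3 * x ≡ x + 2 * x
      r₁ = solve-∀
      r₂ : ∀ x → 4 * x + 2 * x ≡ 2 * (3 * x)
      r₂ = solve-∀
      r₃ : ∀ x x′ → 4 * x + 2 * x′ ≡ 2 * (x′ + 2 * x)
      r₃ = solve-∀
    double : ∀ {k d} → k < d → suc k < 2 * d
    double {k} {suc d} (s≤s k≤d) = s≤s (≤-trans (s≤s k≤d) (≤-trans (m≤m+n (suc d) d)
      (≤-reflexive (lemma d))))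
      where
      lemma : ∀ d → suc d + d ≡ d + (suc d + 0)
      lemma = solve-∀
    grow : ∀ k → ∃ λ y → Λ y × k < D y
    grow zero    = x₀ , l₀ , subst (0 <_) (sym eq) (s≤s z≤n)
    grow (suc k) with grow k
    ... | y , l , k<Dy with next l
    ...   | y′ , l′ , e = y′ , l′ , subst (suc k <_) (sym (D-next {y} {y′} e)) (double k<Dy)
    unbounded : (∃ λ y → Λ y × 3 * h + T < D y) → ⊥
    unbounded (y , l , lt) = <⇒≱ lt (≤-trans (∣m-n∣≤m⊔n (3 * y) T)
      (≤-trans (m⊔n≤m+n (3 * y) T) (+-monoˡ-≤ T (*-monoʳ-≤ 3 (bounded l)))))

  -- Points with c < 2x are mapped to points with the same property, so they cannot be entered from outside.
  module _ {p c h : ℕ} (Λ : ℕ → Set) (2h<p : 2 * h < p) (bounded : ∀ {x} → Λ x → x ≤ h)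
    (next : ∀ {x} → Λ x → ∃ λ x′ → Λ x′ × (x′ + 2 * x ≡ c ⊎ x′ + 2 * x ≡ c + p)) where

    Low High : ℕ → Set
    Low x  = Λ x × 2 * x ≤ c
    High x = Λ x × c < 2 * x

    2x<p : ∀ {x} → Λ x → 2 * x < p
    2x<p l = ≤-<-trans (*-monoʳ-≤ 2 (bounded l)) 2h<p

    High-next : ∀ {x} → High x → ∃ λ x′ → High x′ × x′ + 2 * x ≡ c + p
    High-next {x} (l , c<2x) with next l
    ... | x′ , l′ , inj₁ e = ⊥-elim (<⇒≱ c<2x (subst (2 * x ≤_) e (m≤n+m (2 * x) x′)))
    ... | x′ , l′ , inj₂ e = x′ , (l′ , <-≤-trans c<x′ (m≤m+n x′ (x′ + 0))) , e
      where
      c<x′ : c < x′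
      c<x′ = +-cancelʳ-< (2 * x) c x′ (subst (c + 2 * x <_) (sym e) (+-monoʳ-< c (2x<p l)))

    High-fixed : ∀ {x} → High x → 3 * x ≡ c + p
    High-fixed = doubling-fixed High (λ hx → bounded (proj₁ hx)) High-next

    Low-next : ∀ {x} → Low x → ∃ λ x′ → Low x′ × x′ + 2 * x ≡ c
    Low-next {x} (l , 2x≤c) with next l
    ... | x′ , l′ , inj₂ e = ⊥-elim (<⇒≱ (≤-<-trans (m≤m+n x′ (x′ + 0)) (2x<p l′))
                               (+-cancelʳ-≤ c p x′ (subst (_≤ x′ + c) (trans e (+-comm c p)) (+-monoʳ-≤ x′ 2x≤c))))
    ... | x′ , l′ , inj₁ e with 2 * x′ ≤? c
    ...   | yes low′ = x′ , (l′ , low′) , e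
    -- A high `x′` is the fixed point 3x′ = c + p; with x′ + 2x = c this gives 2x′ = p + 2x,
    -- although 2x′ is below `p`.
    ...   | no high′ = ⊥-elim (<⇒≢ (≤-<-trans (m∸n≤m (2 * x′) (2 * x)) (2x<p l′)) (trans (cong (_∸ 2 * x) 2x′≡) (m+n∸n≡m p (2 * x))))
      where
      lemma : ∀ x x′ p → x′ + 2 * x + p ≡ x′ + (p + 2 * x)
      lemma = solve-∀
      2x′≡ : 2 * x′ ≡ p + 2 * x
      2x′≡ = +-cancelˡ-≡ x′ (2 * x′) (p + 2 * x) (trans (High-fixed (l′ , ≰⇒> high′))
        (trans (cong (_+ p) (sym e)) (lemma x x′ p)))

    arc-fixed : ∀ {x} → Λ x → 3 * x ≡ c ⊎ 3 * x ≡ c + p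
    arc-fixed {x} l with 2 * x ≤? c
    ... | yes low = inj₁ (doubling-fixed Low (λ hx → bounded (proj₁ hx)) Low-next (l , low))
    ... | no high = inj₂ (High-fixed (l , ≰⇒> high))

-- Arithmetic modulo p and a non-square.

module Residues where

  open Injections
  open import Data.Nat as ℕ using (ℕ; zero; suc; s≤s; z≤n)
  import Data.Nat.Properties as ℕ
  import Data.Nat.Divisibility as ℕ
  open import Data.Nat.Primality using (Prime; euclidsLemma)
  open import Data.Integer using (ℤ; +_; -_; _+_; _*_; _-_; ∣_∣; 0ℤ; 1ℤ)
  open import Data.Integer.Properties using (abs-*; +-inverseʳ; m-n≡m⊖n; ⊖-≥; pos-+; *-zeroˡ)
  open import Data.Integer.DivMod using (_/ℕ_; n%ℕd<d; a≡a%ℕn+[a/ℕn]*n)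
  open import Data.Integer.Divisibility.Signed using (_∣_; divides; _∣?_; ∣⇒∣ᵤ; ∣ᵤ⇒∣; ∣m∣n⇒∣m+n; ∣n⇒∣m*n)
  open import Data.Integer.Tactic.RingSolver using (solve-∀; solve)
  open import Data.List using (_∷_; [])
  open import Data.Fin using (Fin; zero; suc; toℕ; fromℕ<)
  open import Data.Fin.Properties using (toℕ<n; toℕ-injective; toℕ-fromℕ<)
  open import Relation.Nullary.Decidable using (map′)

  module Modular (m : ℕ) (2≤m : 2 ℕ.≤ m) (prime : Prime (suc (m ℕ.+ m))) where

    p : ℕ
    p = suc (m ℕ.+ m)

    infix 4 _≈_ _≉_ _≈?_
    record _≈_ (a b : ℤ) : Set where
      constructor congruent
      field divisor : + p ∣ a - b

    open _≈_

    _≉_ : ℤ → ℤ → Set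
    a ≉ b = ¬ (a ≈ b)

    _≈?_ : ∀ a b → Dec (a ≈ b)
    a ≈? b = map′ congruent divisor (+ p ∣? a - b)

    ≈-refl : ∀ {a} → a ≈ a
    ≈-refl {a} = congruent (divides 0ℤ (trans (+-inverseʳ a) (sym (*-zeroˡ (+ p)))))

    ≡⇒≈ : ∀ {a b} → a ≡ b → a ≈ b
    ≡⇒≈ refl = ≈-refl

    -- The ring solver supplies the last argument, which works in ℤ rather than modulo p.
    combine₁ : ∀ {x y a b} k → a ≈ b → x - y ≡ k * (a - b) → x ≈ y
    combine₁ k h e = congruent (subst (+ p ∣_) (sym e) (∣n⇒∣m*n k (divisor h)))

    combine₂ : ∀ {x y a b c d} k l → a ≈ b → c ≈ d → x - y ≡ k * (a - b) + l * (c - d) → x ≈ y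
    combine₂ k l h h′ e = congruent (subst (+ p ∣_) (sym e)
      (∣m∣n⇒∣m+n (∣n⇒∣m*n k (divisor h)) (∣n⇒∣m*n l (divisor h′))))

    combine₃ : ∀ {x y a b c d f g} k l q → a ≈ b → c ≈ d → f ≈ g →
      x - y ≡ k * (a - b) + l * (c - d) + q * (f - g) → x ≈ y
    combine₃ k l q h h′ h″ e = congruent (subst (+ p ∣_) (sym e)
      (∣m∣n⇒∣m+n (∣m∣n⇒∣m+n (∣n⇒∣m*n k (divisor h)) (∣n⇒∣m*n l (divisor h′))) (∣n⇒∣m*n q (divisor h″))))

    ≈-sym : ∀ {a b} → a ≈ b → b ≈ a
    ≈-sym {a} {b} h = combine₁ (- 1ℤ) h (solve (a ∷ b ∷ []))

    ≈-trans : ∀ {a b c} → a ≈ b → b ≈ c → a ≈ c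
    ≈-trans {a} {b} {c} h h′ = combine₂ 1ℤ 1ℤ h h′ (solve (a ∷ b ∷ c ∷ []))

    p≈0 : + p ≈ 0ℤ
    p≈0 = congruent (divides 1ℤ (lemma (+ p)))
      where
      lemma : ∀ q → q - 0ℤ ≡ 1ℤ * q
      lemma = solve-∀

    ι : Fin p → ℤ
    ι i = + toℕ i

    abstract
      red : ℤ → Fin p
      red z = fromℕ< (n%ℕd<d z p)

      ι-red : ∀ z → ι (red z) ≈ z
      ι-red z = congruent (divides (- (z /ℕ p)) (lemma (ι (red z)) z (z /ℕ p) (+ p)
        (trans (a≡a%ℕn+[a/ℕn]*n z p) (cong (λ k → + k + (z /ℕ p) * + p) (sym (toℕ-fromℕ< (n%ℕd<d z p)))))))
        where
        lemma : ∀ r z q P → z ≡ r + q * P → r - z ≡ - q * P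
        lemma r z q P refl = solve (r ∷ q ∷ P ∷ [])

    small-≈ : ∀ {a b} → a ℕ.≤ b → b ℕ.< p → + b ≈ + a → b ≡ a
    small-≈ {a} {b} a≤b b<p (congruent d) = lemma (b ℕ.∸ a) refl
      (subst (p ℕ.∣_) (cong ∣_∣ (trans (m-n≡m⊖n b a) (⊖-≥ a≤b))) (∣⇒∣ᵤ d))
      where
      lemma : ∀ k → b ℕ.∸ a ≡ k → p ℕ.∣ b ℕ.∸ a → b ≡ a
      lemma zero    e _ = ℕ.≤-antisym (ℕ.m∸n≡0⇒m≤n e) a≤b
      lemma (suc k) e d′ = ⊥-elim (ℕ.≤⇒≯ (ℕ.∣⇒≤ (subst (p ℕ.∣_) e d′))
        (ℕ.≤-<-trans (subst (ℕ._≤ b) e (ℕ.m∸n≤m b a)) b<p))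

    nat-≈ : ∀ {a b} → a ℕ.< p → b ℕ.< p → + a ≈ + b → a ≡ b
    nat-≈ {a} {b} a<p b<p h with ℕ.≤-total a b
    ... | inj₁ a≤b = sym (small-≈ a≤b b<p (≈-sym h))
    ... | inj₂ b≤a = small-≈ b≤a a<p h

    ι-inj : ∀ {i j} → ι i ≈ ι j → i ≡ j
    ι-inj {i} {j} h = toℕ-injective (nat-≈ (toℕ<n i) (toℕ<n j) h)

    red-cong : ∀ {a b} → a ≈ b → red a ≡ red b
    red-cong {a} {b} h = ι-inj (≈-trans (ι-red a) (≈-trans h (≈-sym (ι-red b))))

    red-ι : ∀ i → red (ι i) ≡ i
    red-ι i = ι-inj (ι-red (ι i))

    nonzero-nat : ∀ {k} → 0 ℕ.< k → k ℕ.< p → + k ≉ 0ℤ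
    nonzero-nat {suc k} _ k<p h with nat-≈ k<p (s≤s z≤n) h
    ... | ()

    minus-zero : ∀ z → z - 0ℤ ≡ z
    minus-zero = solve-∀

    ∣⇒≈0 : ∀ z → p ℕ.∣ ∣ z ∣ → z ≈ 0ℤ
    ∣⇒≈0 z d = congruent (subst (+ p ∣_) (sym (minus-zero z)) (∣ᵤ⇒∣ d))

    abstract
      euclid : ∀ a b → a * b ≈ 0ℤ → a ≈ 0ℤ ⊎ b ≈ 0ℤ
      euclid a b (congruent d) = Sum.map (∣⇒≈0 a) (∣⇒≈0 b) (euclidsLemma ∣ a ∣ ∣ b ∣ prime
        (subst (p ℕ.∣_) (abs-* a b) (∣⇒∣ᵤ (subst (+ p ∣_) (minus-zero (a * b)) d))))

    cancel : ∀ {k a b} → k ≉ 0ℤ → k * a ≈ k * b → a ≈ b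
    cancel {k} {a} {b} k≉0 h = Sum.[ (λ q → ⊥-elim (k≉0 q)) , (λ q → combine₁ 1ℤ q (lemma a b)) ]
      (euclid k (a - b) (combine₁ 1ℤ h (lemma′ k a b)))
      where
      lemma : ∀ a b → a - b ≡ 1ℤ * (a - b - 0ℤ)
      lemma = solve-∀
      lemma′ : ∀ k a b → k * (a - b) - 0ℤ ≡ 1ℤ * (k * a - k * b)
      lemma′ = solve-∀

    abstract
      -- Multiplication by `a` is injective on the residues, hence onto.
      divide : ∀ {a} → a ≉ 0ℤ → ∀ b → ∃ λ k → a * ι k ≈ b
      divide {a} a≉0 b = proj₁ preimage ,
        ≈-trans (≈-sym (ι-red (a * ι (proj₁ preimage)))) (≈-trans (≡⇒≈ (cong ι (proj₂ preimage))) (ι-red b))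
        where
        times-inj : Inj (λ k → red (a * ι k))
        times-inj {k} {l} e = ι-inj (cancel a≉0 (≈-trans (≈-sym (ι-red (a * ι k))) (≈-trans (≡⇒≈ (cong ι e)) (ι-red (a * ι l)))))
        preimage : ∃ λ k → red (a * ι k) ≡ red b
        preimage = inj⇒onto times-inj (red b)

    m<p : m ℕ.< p
    m<p = s≤s (ℕ.m≤m+n m m)

    2≉0 : + 2 ≉ 0ℤ
    2≉0 = nonzero-nat (s≤s z≤n) (ℕ.≤-<-trans 2≤m m<p)

    3≉0 : + 3 ≉ 0ℤ
    3≉0 = nonzero-nat (s≤s z≤n) (s≤s (ℕ.≤-trans (s≤s (s≤s (s≤s z≤n))) (ℕ.+-mono-≤ 2≤m 2≤m)))

    1≉0 : 1ℤ ≉ 0ℤ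
    1≉0 = nonzero-nat (s≤s z≤n) (ℕ.<-trans (s≤s (s≤s z≤n)) (ℕ.≤-<-trans 2≤m m<p))

    -- Since z and -z have the same square, all squares come from 0, ..., m; these m + 1 values
    -- cannot fill 2m + 1 residues.
    non-square : ∃ λ N → ∀ z → z * z ≉ N
    non-square with missed-value {suc m} {p} (λ a → red (+ toℕ a * + toℕ a))
                      (s≤s (ℕ.m<m+n m (ℕ.≤-trans (s≤s z≤n) 2≤m)))
    ... | N , h = ι N , avoid
      where
      small : ∀ k → k ℕ.≤ m → ∀ z → z ≈ + k ⊎ z ≈ - + k → z * z ≉ ι N
      small k k≤m z hz e = h (fromℕ< (s≤s k≤m)) (trans (cong (λ a → red (+ a * + a)) (toℕ-fromℕ< (s≤s k≤m)))
        (trans (red-cong (≈-trans (≈-sym (squares hz)) e)) (red-ι N)))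
        where
        squares : z ≈ + k ⊎ z ≈ - + k → z * z ≈ + k * + k
        squares (inj₁ q) = combine₁ (z + + k) q (lemma z (+ k))
          where
          lemma : ∀ z k → z * z - k * k ≡ (z + k) * (z - k)
          lemma = solve-∀
        squares (inj₂ q) = combine₁ (z - + k) q (lemma z (+ k))
          where
          lemma : ∀ z k → z * z - k * k ≡ (z - k) * (z - - k)
          lemma = solve-∀
      avoid : ∀ z → z * z ≉ ι N
      avoid z with toℕ (red z) ℕ.≤? m
      ... | yes k≤m = small (toℕ (red z)) k≤m z (inj₁ (≈-sym (ι-red z)))
      ... | no k≰m = small (p ℕ.∸ toℕ (red z)) p∸k≤m z (inj₂ (combine₂ 1ℤ 1ℤ (≈-sym (ι-red z)) p≈0
                       (lemma z (ι (red z)) (+ (p ℕ.∸ toℕ (red z))) (+ p) sum≡)))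
        where
        sum≡ : + p ≡ + (p ℕ.∸ toℕ (red z)) + ι (red z)
        sum≡ = trans (cong +_ (sym (ℕ.m∸n+n≡m (ℕ.<⇒≤ (toℕ<n (red z)))))) (pos-+ (p ℕ.∸ toℕ (red z)) (toℕ (red z)))
        p∸k≤m : p ℕ.∸ toℕ (red z) ℕ.≤ m
        p∸k≤m = ℕ.≤-trans (ℕ.∸-monoʳ-≤ p (ℕ.≰⇒> k≰m)) (ℕ.≤-reflexive (ℕ.m+n∸m≡n m m))
        lemma : ∀ z k l P → P ≡ l + k → z - - l ≡ 1ℤ * (z - k) + 1ℤ * (P - 0ℤ)
        lemma z k l P refl = solve (z ∷ k ∷ l ∷ [])

    abstract
      -- If x were invertible, y / x would be a square root of the non-square `N`.
      anisotropic : ∃ λ N → ∀ x y → y * y ≈ N * x * x → x ≈ 0ℤ × y ≈ 0ℤ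
      anisotropic with non-square
      ... | N , h = N , zero-only
        where
        zero-only : ∀ x y → y * y ≈ N * x * x → x ≈ 0ℤ × y ≈ 0ℤ
        zero-only x y e with x ≈? 0ℤ
        ... | yes x≈0 = x≈0 , y≈0 (euclid y y (combine₂ 1ℤ (N * x) e x≈0 (lemma N x y)))
          where
          y≈0 : y ≈ 0ℤ ⊎ y ≈ 0ℤ → y ≈ 0ℤ
          y≈0 (inj₁ q) = q
          y≈0 (inj₂ q) = q
          lemma : ∀ N x y → y * y - 0ℤ ≡ 1ℤ * (y * y - N * x * x) + N * x * (x - 0ℤ)
          lemma = solve-∀
        ... | no x≉0 = ⊥-elim (quotient-square (divide x≉0 1ℤ))
          where
          quotient-square : (∃ λ k → x * ι k ≈ 1ℤ) → ⊥
          quotient-square (k , q) = h (y * ι k) (combine₂ (ι k * ι k) (N * (x * ι k + 1ℤ)) e q (lemma N x y (ι k)))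
            where
            lemma : ∀ N x y w → y * w * (y * w) - N ≡ w * w * (y * y - N * x * x) + N * (x * w + 1ℤ) * (x * w - 1ℤ)
            lemma = solve-∀

-- Transitivity of the walk on pairs of blocks.

module Orbits where

  open Residues
  open import Data.Nat as ℕ using (ℕ; zero; suc; s≤s; z≤n)
  import Data.Nat.Properties as ℕ
  open import Data.Nat.Primality using (Prime)
  open import Data.Integer using (ℤ; +_; -_; _+_; _*_; _-_; 0ℤ; 1ℤ)
  open import Data.Integer.Tactic.RingSolver using (solve-∀)
  open import Data.Fin using (zero; suc; toℕ)
  open import Data.Fin.Properties using (toℕ<n)

  module BlockWalks (m : ℕ) (2≤m : 2 ℕ.≤ m) (prime : Prime (suc (m ℕ.+ m))) where
    open Modular m 2≤m prime

    -- The displacement a + b[z = 0] of the base colours, as a relation.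
    Kick : ℤ → ℤ → ℤ → ℤ → Set
    Kick z a b δ = (z ≉ 0ℤ × δ ≈ a) ⊎ (z ≈ 0ℤ × δ ≈ a + b)

    -- Here `x` and `y` are the differences of two base colours, and `S i j` says that the edge of
    -- the first colour between blocks i and j lies on a closed set. `S-step` is one round: the
    -- second colour changes i under the control of j, then the first colour changes j under the
    -- control of the new i.
    module Orbit (N x y : ℤ) (N-anisotropic : ∀ x y → y * y ≈ N * x * x → x ≈ 0ℤ × y ≈ 0ℤ)
      (S : ℤ → ℤ → Set)
      (S-resp : ∀ {i j i′ j′} → i ≈ i′ → j ≈ j′ → S i j → S i′ j′)
      (S-step : ∀ {i j i′ j′ δ ε} → Kick j y (N * x) δ → i′ ≈ i + δ → Kick i′ x y ε → j′ ≈ j - ε →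
         (S i j → S i′ j′) × (S i′ j′ → S i j))
      where

      -- Rescaled coordinates i = a K and j = b T, chosen in each case so that the regular part of a
      -- step is a unit step.
      module Walk (a b : ℤ) where

        At : ℤ × ℤ → Set
        At (K , T) = S (a * K) (b * T)

        infix 4 _~_
        record _~_ (s t : ℤ × ℤ) : Set where
          constructor both
          field directions : (At s → At t) × (At t → At s)

        open _~_ public

        ~-trans : ∀ {s t u} → s ~ t → t ~ u → s ~ u
        ~-trans (both (f , g)) (both (h , k)) = both ((λ q → h (f q)) , (λ q → g (k q)))

        ~-sym : ∀ {s t} → s ~ t → t ~ s
        ~-sym (both (f , g)) = both (g , f)

        ~-resp : ∀ {K T K′ T′} → K ≈ K′ → T ≈ T′ → (K , T) ~ (K′ , T′)
        ~-resp {K} {T} {K′} {T′} h h′ =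
          both (S-resp (combine₁ a h (lemma a K K′)) (combine₁ b h′ (lemma b T T′)) ,
                S-resp (combine₁ a (≈-sym h) (lemma a K′ K)) (combine₁ b (≈-sym h′) (lemma b T′ T)))
          where
          lemma : ∀ a K K′ → a * K - a * K′ ≡ a * (K - K′)
          lemma = solve-∀

      below : ∀ {q r} → q ℕ.< r → r ℕ.< p → + r - + q ≉ 0ℤ
      below {q} {r} q<r r<p h = ℕ.<⇒≢ q<r (sym (nat-≈ r<p (ℕ.<-trans q<r r<p) (combine₁ 1ℤ h (lemma (+ r) (+ q)))))
        where
        lemma : ∀ r q → r - q ≡ 1ℤ * (r - q - 0ℤ)
        lemma = solve-∀

      -- With i = y K and j = - x T, a step adds 1 to K and to T, and in addition e to K if T = 0 and then d to T
      -- if K = 0. Since d ≠ e, going on to K = 0 and then to T = 0 shifts K by e - d ≠ 0.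
      module Generic (x≉0 : x ≉ 0ℤ) (y≉0 : y ≉ 0ℤ) where

        open Walk y (- x)

        d e : ℤ
        d = ι (proj₁ (divide x≉0 y))
        e = ι (proj₁ (divide y≉0 (N * x)))
        xd≈y : x * d ≈ y
        xd≈y = proj₂ (divide x≉0 y)
        ye≈Nx : y * e ≈ N * x
        ye≈Nx = proj₂ (divide y≉0 (N * x))

        -- Equality would read N x / y = y / x, that is y² = N x².
        e-d≉0 : e - d ≉ 0ℤ
        e-d≉0 h = x≉0 (proj₁ (N-anisotropic x y (combine₃ (- y) x (- (x * y)) xd≈y ye≈Nx h (lemma x y N d e))))
          where
          lemma : ∀ x y N d e → y * y - N * x * x ≡ - y * (x * d - y) + x * (y * e - N * x) + - (x * y) * (e - d - 0ℤ)
          lemma = solve-∀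

        step : ∀ {K T K′ T′ e′ d′} → Kick T 0ℤ e e′ → K′ ≈ K + 1ℤ + e′ → Kick K′ 0ℤ d d′ → T′ ≈ T + 1ℤ + d′ →
          (K , T) ~ (K′ , T′)
        step {K} {T} {K′} {T′} {e′} {d′} k hK k′ hT = both (S-step {δ = y + y * e′} {ε = x + x * d′}
          (Sum.map (λ { (T≉0 , q) → (λ h → T≉0 (cancel {k = - x} (λ z → x≉0 (combine₁ (- 1ℤ) z (r₁ x))) (combine₁ 1ℤ h (r₂ x T)))) ,
                                    combine₁ y q (r₃ y e′) })
                   (λ { (T≈0 , q) → combine₁ (- x) T≈0 (r₄ x T) , combine₂ y 1ℤ q ye≈Nx (r₅ x y N e e′) }) k)
          (combine₁ y hK (r₆ y K K′ e′))
          (Sum.map (λ { (K≉0 , q) → (λ h → K≉0 (cancel y≉0 (combine₁ 1ℤ h (r₇ y K′)))) , combine₁ x q (r₃ x d′) })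
                   (λ { (K≈0 , q) → combine₁ y K≈0 (r₈ y K′) , combine₂ x 1ℤ q xd≈y (r₉ x y d d′) }) k′)
          (combine₁ (- x) hT (r₁₀ x T T′ d′)))
          where
          r₁ : ∀ x → x - 0ℤ ≡ - 1ℤ * (- x - 0ℤ)
          r₁ = solve-∀
          r₂ : ∀ x T → - x * T - - x * 0ℤ ≡ 1ℤ * (- x * T - 0ℤ)
          r₂ = solve-∀
          r₃ : ∀ y e → y + y * e - y ≡ y * (e - 0ℤ)
          r₃ = solve-∀
          r₄ : ∀ x T → - x * T - 0ℤ ≡ - x * (T - 0ℤ)
          r₄ = solve-∀
          r₅ : ∀ x y N e e′ → y + y * e′ - (y + N * x) ≡ y * (e′ - (0ℤ + e)) + 1ℤ * (y * e - N * x)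
          r₅ = solve-∀
          r₆ : ∀ y K K′ e → y * K′ - (y * K + (y + y * e)) ≡ y * (K′ - (K + 1ℤ + e))
          r₆ = solve-∀
          r₇ : ∀ y K → y * K - y * 0ℤ ≡ 1ℤ * (y * K - 0ℤ)
          r₇ = solve-∀
          r₈ : ∀ y K → y * K - 0ℤ ≡ y * (K - 0ℤ)
          r₈ = solve-∀
          r₉ : ∀ x y d d′ → x + x * d′ - (x + y) ≡ x * (d′ - (0ℤ + d)) + 1ℤ * (x * d - y)
          r₉ = solve-∀
          r₁₀ : ∀ x T T′ d → - x * T′ - (- x * T - (x + x * d)) ≡ - x * (T′ - (T + 1ℤ + d))
          r₁₀ = solve-∀

        -- The ranges differ by one because a step tests `T` before its increment and `K` after it.
        run : ∀ n {K T} → (∀ q → q ℕ.< n → K + + suc q ≉ 0ℤ) → (∀ q → q ℕ.< n → T + + q ≉ 0ℤ) →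
          (K , T) ~ (K + + n , T + + n)
        run zero    {K} {T} hK hT = ~-resp (≡⇒≈ (lemma K)) (≡⇒≈ (lemma T))
          where
          lemma : ∀ K → K ≡ K + 0ℤ
          lemma = solve-∀
        run (suc n) {K} {T} hK hT = ~-trans (run n (λ q q<n → hK q (ℕ.m<n⇒m<1+n q<n)) (λ q q<n → hT q (ℕ.m<n⇒m<1+n q<n)))
          (step {e′ = 0ℤ} {d′ = 0ℤ} (inj₁ (hT n (ℕ.n<1+n n) , ≈-refl)) (≡⇒≈ (lemma K (+ n)))
                (inj₁ (hK n (ℕ.n<1+n n) , ≈-refl)) (≡⇒≈ (lemma T (+ n))))
          where
          lemma : ∀ K n → K + (1ℤ + n) ≡ K + n + 1ℤ + 0ℤ
          lemma = solve-∀

        from-K≈0 : ∀ T → (0ℤ , T) ~ (- T , 0ℤ)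
        from-K≈0 T = ~-trans (run (toℕ q) {0ℤ} {T}
          (λ k k<q → λ h → nonzero-nat (s≤s z≤n) (ℕ.≤-<-trans k<q (toℕ<n q)) (≈-trans (≡⇒≈ (r₁ (+ suc k))) h))
          (λ k k<q h → below k<q (toℕ<n q) (combine₂ (- 1ℤ) 1ℤ h (ι-red (- T)) (r₂ (ι q) (+ k) T))))
          (~-resp (combine₁ 1ℤ (ι-red (- T)) (r₃ (ι q) T)) (combine₁ 1ℤ (ι-red (- T)) (r₄ (ι q) T)))
          where
          q = red (- T)
          r₁ : ∀ k → k ≡ 0ℤ + k
          r₁ = solve-∀
          r₂ : ∀ q k T → q - k - 0ℤ ≡ - 1ℤ * (T + k - 0ℤ) + 1ℤ * (q - - T)
          r₂ = solve-∀
          r₃ : ∀ q T → 0ℤ + q - - T ≡ 1ℤ * (q - - T)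
          r₃ = solve-∀
          r₄ : ∀ q T → T + q - 0ℤ ≡ 1ℤ * (q - - T)
          r₄ = solve-∀

        -- The first time K becomes 0, starting from T = 0.
        to-K≈0 : ∀ K → (K , 0ℤ) ~ (0ℤ , d - e - K)
        to-K≈0 K = go (toℕ l) (toℕ<n l) (ι-red (- (K + e) - 1ℤ))
          where
          l = red (- (K + e) - 1ℤ)
          go : ∀ n → n ℕ.< p → + n ≈ - (K + e) - 1ℤ → (K , 0ℤ) ~ (0ℤ , d - e - K)
          -- Here the kick at T = 0 already brings `K` to 0, so `T` receives `d` in the same step.
          go zero n<p h = step {e′ = e} {d′ = d} (inj₂ (≈-refl , ≡⇒≈ (r₀ e))) (combine₁ (- 1ℤ) h (r₁ K e))
            (inj₂ (≈-refl , ≡⇒≈ (r₀ d))) (combine₁ (- 1ℤ) h (r₂ K d e))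
            where
            r₀ : ∀ e → e ≡ 0ℤ + e
            r₀ = solve-∀
            r₁ : ∀ K e → 0ℤ - (K + 1ℤ + e) ≡ - 1ℤ * (0ℤ - (- (K + e) - 1ℤ))
            r₁ = solve-∀
            r₂ : ∀ K d e → d - e - K - (0ℤ + 1ℤ + d) ≡ - 1ℤ * (0ℤ - (- (K + e) - 1ℤ))
            r₂ = solve-∀
          go (suc n) n<p h = ~-trans first (~-trans middle last)
            where
            first : (K , 0ℤ) ~ (- + suc n , 1ℤ)
            first = step {e′ = e} {d′ = 0ℤ} (inj₂ (≈-refl , ≡⇒≈ (r₀ e))) (combine₁ (- 1ℤ) h (r₁ K e (+ suc n)))
              (inj₁ ((λ z → nonzero-nat (s≤s z≤n) n<p (combine₁ (- 1ℤ) z (r₂ (+ suc n)))) , ≈-refl)) ≈-refl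
              where
              r₀ : ∀ e → e ≡ 0ℤ + e
              r₀ = solve-∀
              r₁ : ∀ K e n → - n - (K + 1ℤ + e) ≡ - 1ℤ * (n - (- (K + e) - 1ℤ))
              r₁ = solve-∀
              r₂ : ∀ n → n - 0ℤ ≡ - 1ℤ * (- n - 0ℤ)
              r₂ = solve-∀
            middle : (- + suc n , 1ℤ) ~ (- + suc n + + n , 1ℤ + + n)
            middle = run n
              (λ q q<n z → below (s≤s q<n) n<p (combine₁ (- 1ℤ) z (r₁ (+ suc n) (+ suc q))))
              (λ q q<n z → nonzero-nat (s≤s z≤n) (ℕ.<-trans (s≤s q<n) n<p) z)
              where
              r₁ : ∀ n q → n - q - 0ℤ ≡ - 1ℤ * (- n + q - 0ℤ)
              r₁ = solve-∀
            last : (- + suc n + + n , 1ℤ + + n) ~ (0ℤ , d - e - K)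
            last = step {e′ = 0ℤ} {d′ = d} (inj₁ ((λ z → nonzero-nat (s≤s z≤n) n<p z) , ≈-refl)) (≡⇒≈ (r₁ (+ n)))
              (inj₂ (≈-refl , ≡⇒≈ (r₂ d))) (combine₁ (- 1ℤ) h (r₃ K d e (+ n)))
              where
              r₁ : ∀ n → 0ℤ ≡ - (1ℤ + n) + n + 1ℤ + 0ℤ
              r₁ = solve-∀
              r₂ : ∀ d → d ≡ 0ℤ + d
              r₂ = solve-∀
              r₃ : ∀ K d e n → d - e - K - (1ℤ + n + 1ℤ + d) ≡ - 1ℤ * (1ℤ + n - (- (K + e) - 1ℤ))
              r₃ = solve-∀

        shift : ∀ K → (K , 0ℤ) ~ (K + (e - d) , 0ℤ)
        shift K = ~-trans (to-K≈0 K) (~-trans (from-K≈0 (d - e - K)) (~-resp (≡⇒≈ (lemma K d e)) ≈-refl))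
          where
          lemma : ∀ K d e → - (d - e - K) ≡ K + (e - d)
          lemma = solve-∀

        shifts : ∀ n K → (K , 0ℤ) ~ (K + (e - d) * + n , 0ℤ)
        shifts zero    K = ~-resp (≡⇒≈ (lemma K (e - d))) ≈-refl
          where
          lemma : ∀ K c → K ≡ K + c * 0ℤ
          lemma = solve-∀
        shifts (suc n) K = ~-trans (shifts n K) (~-trans (shift (K + (e - d) * + n)) (~-resp (≡⇒≈ (lemma K (e - d) (+ n))) ≈-refl))
          where
          lemma : ∀ K c n → K + c * n + c ≡ K + c * (1ℤ + n)
          lemma = solve-∀

        all-T≈0 : ∀ K K′ → (K , 0ℤ) ~ (K′ , 0ℤ)
        all-T≈0 K K′ = ~-trans (shifts (toℕ (proj₁ k)) K) (~-resp (combine₁ 1ℤ (proj₂ k) (lemma K K′ (e - d) (ι (proj₁ k)))) ≈-refl)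
          where
          k = divide e-d≉0 (K′ - K)
          lemma : ∀ K K′ c k → K + c * k - K′ ≡ 1ℤ * (c * k - (K′ - K))
          lemma = solve-∀

        -- `T` vanishes after `q` regular steps and `K` after r + 1. If `K` comes first, `T` is
        -- kicked, and from K = 0 there is time to reach T = 0 before `K` vanishes again.
        reach-T≈0 : ∀ K T → ∃ λ K′ → (K , T) ~ (K′ , 0ℤ)
        reach-T≈0 K T = go (toℕ (red (- T))) (toℕ<n (red (- T))) (ι-red (- T))
                           (toℕ (red (- K - 1ℤ))) (toℕ<n (red (- K - 1ℤ))) (ι-red (- K - 1ℤ))
          where
          go : ∀ q → q ℕ.< p → + q ≈ - T → ∀ r → r ℕ.< p → + r ≈ - K - 1ℤ → ∃ λ K′ → (K , T) ~ (K′ , 0ℤ)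
          go q q<p hq r r<p hr with q ℕ.≤? r
          ... | yes q≤r = K + + q , ~-trans (run q
                  (λ k k<q z → below (ℕ.<-≤-trans k<q q≤r) r<p (combine₂ (- 1ℤ) 1ℤ z hr (r₁ K (+ k) (+ r))))
                  (λ k k<q z → below k<q q<p (combine₂ (- 1ℤ) 1ℤ z hq (r₂ T (+ k) (+ q)))))
                  (~-resp ≈-refl (combine₁ 1ℤ hq (r₃ T (+ q))))
            where
            r₁ : ∀ K k r → r - k - 0ℤ ≡ - 1ℤ * (K + (1ℤ + k) - 0ℤ) + 1ℤ * (r - (- K - 1ℤ))
            r₁ = solve-∀
            r₂ : ∀ T k q → q - k - 0ℤ ≡ - 1ℤ * (T + k - 0ℤ) + 1ℤ * (q - - T)
            r₂ = solve-∀
            r₃ : ∀ T q → T + q - 0ℤ ≡ 1ℤ * (q - - T)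
            r₃ = solve-∀
          ... | no q≰r = _ , ~-trans (run r
                  (λ k k<r z → below k<r r<p (combine₂ (- 1ℤ) 1ℤ z hr (r₁ K (+ k) (+ r))))
                  (λ k k<r z → below (ℕ.<-trans k<r (ℕ.≰⇒> q≰r)) q<p (combine₂ (- 1ℤ) 1ℤ z hq (r₂ T (+ k) (+ q)))))
                  (~-trans (step {K′ = 0ℤ} {T′ = T + + r + 1ℤ + d} {e′ = 0ℤ} {d′ = d}
                      (inj₁ ((λ z → below (ℕ.≰⇒> q≰r) q<p (combine₂ (- 1ℤ) 1ℤ z hq (r₂ T (+ r) (+ q)))) , ≈-refl))
                      (combine₁ (- 1ℤ) hr (r₄ K (+ r))) (inj₂ (≈-refl , ≡⇒≈ (r₅ d))) ≈-refl)
                    (from-K≈0 (T + + r + 1ℤ + d)))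
            where
            r₁ : ∀ K k r → r - k - 0ℤ ≡ - 1ℤ * (K + (1ℤ + k) - 0ℤ) + 1ℤ * (r - (- K - 1ℤ))
            r₁ = solve-∀
            r₂ : ∀ T k q → q - k - 0ℤ ≡ - 1ℤ * (T + k - 0ℤ) + 1ℤ * (q - - T)
            r₂ = solve-∀
            r₄ : ∀ K r → 0ℤ - (K + r + 1ℤ + 0ℤ) ≡ - 1ℤ * (r - (- K - 1ℤ))
            r₄ = solve-∀
            r₅ : ∀ d → d ≡ 0ℤ + d
            r₅ = solve-∀

        all : ∀ s t → s ~ t
        all (K , T) (K′ , T′) = ~-trans (proj₂ (reach-T≈0 K T)) (~-trans (all-T≈0 _ _) (~-sym (proj₂ (reach-T≈0 K′ T′))))

        everywhere : ∀ {i j} i′ j′ → S i j → S i′ j′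
        everywhere {i} {j} i′ j′ q = S-resp (coord y≉0 i′) (coord -x≉0 j′)
          (proj₁ (directions (all (K i , T j) (K i′ , T j′))) (S-resp (≈-sym (coord y≉0 i)) (≈-sym (coord -x≉0 j)) q))
          where
          -x≉0 : - x ≉ 0ℤ
          -x≉0 z = x≉0 (combine₁ (- 1ℤ) z (lemma x))
            where
            lemma : ∀ x → x - 0ℤ ≡ - 1ℤ * (- x - 0ℤ)
            lemma = solve-∀
          K T : ℤ → ℤ
          K i = ι (proj₁ (divide y≉0 i))
          T j = ι (proj₁ (divide -x≉0 j))
          coord : ∀ {a} (a≉0 : a ≉ 0ℤ) z → a * ι (proj₁ (divide a≉0 z)) ≈ z
          coord a≉0 z = proj₂ (divide a≉0 z)

      -- The walk is an odometer: i advances by y at every step, and j moves by -y only when i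
      -- arrives at 0.
      module Horizontal (x≈0 : x ≈ 0ℤ) (y≉0 : y ≉ 0ℤ) where

        open Walk y 1ℤ

        step : ∀ {K T K′ T′} → K′ ≈ K + 1ℤ → (K′ ≉ 0ℤ × T′ ≈ T) ⊎ (K′ ≈ 0ℤ × T′ ≈ T - y) → (K , T) ~ (K′ , T′)
        step {K} {T} {K′} {T′} hK h = both (S-step {δ = y} {ε = T - T′} kick (combine₁ y hK (r₁ y K K′))
          (Sum.map (λ { (K≉0 , q) → (λ z → K≉0 (cancel y≉0 (combine₁ 1ℤ z (r₂ y K′)))) , combine₂ (- 1ℤ) (- 1ℤ) q x≈0 (r₃ x T T′) })
                   (λ { (K≈0 , q) → combine₁ y K≈0 (r₄ y K′) , combine₂ (- 1ℤ) (- 1ℤ) q x≈0 (r₅ x y T T′) }) h)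
          (≡⇒≈ (r₆ T T′)))
          where
          kick : Kick (1ℤ * T) y (N * x) y
          kick with 1ℤ * T ≈? 0ℤ
          ... | yes z = inj₂ (z , combine₁ (- N) x≈0 (lemma x y N))
            where
            lemma : ∀ x y N → y - (y + N * x) ≡ - N * (x - 0ℤ)
            lemma = solve-∀
          ... | no ¬z = inj₁ (¬z , ≈-refl)
          r₁ : ∀ y K K′ → y * K′ - (y * K + y) ≡ y * (K′ - (K + 1ℤ))
          r₁ = solve-∀
          r₂ : ∀ y K → y * K - y * 0ℤ ≡ 1ℤ * (y * K - 0ℤ)
          r₂ = solve-∀
          r₃ : ∀ x T T′ → T - T′ - x ≡ - 1ℤ * (T′ - T) + - 1ℤ * (x - 0ℤ)
          r₃ = solve-∀
          r₄ : ∀ y K → y * K - 0ℤ ≡ y * (K - 0ℤ)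
          r₄ = solve-∀
          r₅ : ∀ x y T T′ → T - T′ - (x + y) ≡ - 1ℤ * (T′ - (T - y)) + - 1ℤ * (x - 0ℤ)
          r₅ = solve-∀
          r₆ : ∀ T T′ → 1ℤ * T′ ≡ 1ℤ * T - (T - T′)
          r₆ = solve-∀

        run : ∀ n {K T} → (∀ q → q ℕ.< n → K + + suc q ≉ 0ℤ) → (K , T) ~ (K + + n , T)
        run zero {K} hK = ~-resp (≡⇒≈ (lemma K)) ≈-refl
          where
          lemma : ∀ K → K ≡ K + 0ℤ
          lemma = solve-∀
        run (suc n) {K} hK = ~-trans (run n (λ q q<n → hK q (ℕ.m<n⇒m<1+n q<n)))
          (step (≡⇒≈ (lemma K (+ n))) (inj₁ (hK n (ℕ.n<1+n n) , ≈-refl)))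
          where
          lemma : ∀ K n → K + (1ℤ + n) ≡ K + n + 1ℤ
          lemma = solve-∀

        to-K≈0 : ∀ K T → (K , T) ~ (0ℤ , T - y)
        to-K≈0 K T = ~-trans (run (toℕ r)
            (λ q q<r z → below q<r (toℕ<n r) (combine₂ (- 1ℤ) 1ℤ z (ι-red (- K - 1ℤ)) (r₁ K (+ q) (ι r)))))
            (step (combine₁ (- 1ℤ) (ι-red (- K - 1ℤ)) (r₂ K (ι r))) (inj₂ (≈-refl , ≈-refl)))
          where
          r = red (- K - 1ℤ)
          r₁ : ∀ K k r → r - k - 0ℤ ≡ - 1ℤ * (K + (1ℤ + k) - 0ℤ) + 1ℤ * (r - (- K - 1ℤ))
          r₁ = solve-∀
          r₂ : ∀ K r → 0ℤ - (K + r + 1ℤ) ≡ - 1ℤ * (r - (- K - 1ℤ))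
          r₂ = solve-∀

        shifts : ∀ n T → (0ℤ , T) ~ (0ℤ , T - y * + n)
        shifts zero    T = ~-resp ≈-refl (≡⇒≈ (lemma T y))
          where
          lemma : ∀ T y → T ≡ T - y * 0ℤ
          lemma = solve-∀
        shifts (suc n) T = ~-trans (shifts n T) (~-trans (to-K≈0 0ℤ (T - y * + n)) (~-resp ≈-refl (≡⇒≈ (lemma T y (+ n)))))
          where
          lemma : ∀ T y n → T - y * n - y ≡ T - y * (1ℤ + n)
          lemma = solve-∀

        all : ∀ s t → s ~ t
        all (K , T) (K′ , T′) = ~-trans (to-K≈0 K T) (~-trans (shifts (toℕ (proj₁ k)) (T - y))
          (~-trans (~-resp ≈-refl (combine₁ (- 1ℤ) (proj₂ k) (lemma T T′ y (ι (proj₁ k))))) (~-sym (to-K≈0 K′ T′))))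
          where
          k = divide y≉0 (T - T′)
          lemma : ∀ T T′ y k → T - y - y * k - (T′ - y) ≡ - 1ℤ * (y * k - (T - T′))
          lemma = solve-∀

        everywhere : ∀ {i j} i′ j′ → S i j → S i′ j′
        everywhere {i} {j} i′ j′ q = S-resp (coord i′) (≡⇒≈ (lemma j′))
          (proj₁ (directions (all (K i , j) (K i′ , j′))) (S-resp (≈-sym (coord i)) (≡⇒≈ (sym (lemma j))) q))
          where
          K : ℤ → ℤ
          K i = ι (proj₁ (divide y≉0 i))
          coord : ∀ z → y * K z ≈ z
          coord z = proj₂ (divide y≉0 z)
          lemma : ∀ j → 1ℤ * j ≡ j
          lemma = solve-∀

      -- The odometer with exchanged roles: j moves by -x at every step, and i is carried by N x
      -- when j was 0. The carry is nonzero by anisotropy at y = 0.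
      module Vertical (x≉0 : x ≉ 0ℤ) (y≈0 : y ≈ 0ℤ) where

        open Walk 1ℤ (- x)

        -x≉0 : - x ≉ 0ℤ
        -x≉0 z = x≉0 (combine₁ (- 1ℤ) z (lemma x))
          where
          lemma : ∀ x → x - 0ℤ ≡ - 1ℤ * (- x - 0ℤ)
          lemma = solve-∀

        Nx≉0 : N * x ≉ 0ℤ
        Nx≉0 z = x≉0 (proj₁ (N-anisotropic x 0ℤ (combine₁ (- x) z (lemma N x))))
          where
          lemma : ∀ N x → 0ℤ * 0ℤ - N * x * x ≡ - x * (N * x - 0ℤ)
          lemma = solve-∀

        step : ∀ {K T K′ T′} → T′ ≈ T + 1ℤ → (T ≉ 0ℤ × K′ ≈ K) ⊎ (T ≈ 0ℤ × K′ ≈ K + N * x) → (K , T) ~ (K′ , T′)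
        step {K} {T} {K′} {T′} hT h = both (S-step {δ = K′ - K} {ε = x}
          (Sum.map (λ { (T≉0 , q) → (λ z → T≉0 (cancel -x≉0 (combine₁ 1ℤ z (r₁ x T)))) , combine₂ 1ℤ (- 1ℤ) q y≈0 (r₂ K K′ y) })
                   (λ { (T≈0 , q) → combine₁ (- x) T≈0 (r₃ x T) , combine₂ 1ℤ (- 1ℤ) q y≈0 (r₄ K K′ x y N) }) h)
          (≡⇒≈ (r₅ K K′)) kick (combine₁ (- x) hT (r₆ x T T′)))
          where
          kick : Kick (1ℤ * K′) x y x
          kick with 1ℤ * K′ ≈? 0ℤ
          ... | yes z = inj₂ (z , combine₁ (- 1ℤ) y≈0 (lemma x y))
            where
            lemma : ∀ x y → x - (x + y) ≡ - 1ℤ * (y - 0ℤ)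
            lemma = solve-∀
          ... | no ¬z = inj₁ (¬z , ≈-refl)
          r₁ : ∀ x T → - x * T - - x * 0ℤ ≡ 1ℤ * (- x * T - 0ℤ)
          r₁ = solve-∀
          r₂ : ∀ K K′ y → K′ - K - y ≡ 1ℤ * (K′ - K) + - 1ℤ * (y - 0ℤ)
          r₂ = solve-∀
          r₃ : ∀ x T → - x * T - 0ℤ ≡ - x * (T - 0ℤ)
          r₃ = solve-∀
          r₄ : ∀ K K′ x y N → K′ - K - (y + N * x) ≡ 1ℤ * (K′ - (K + N * x)) + - 1ℤ * (y - 0ℤ)
          r₄ = solve-∀
          r₅ : ∀ K K′ → 1ℤ * K′ ≡ 1ℤ * K + (K′ - K)
          r₅ = solve-∀
          r₆ : ∀ x T T′ → - x * T′ - (- x * T - x) ≡ - x * (T′ - (T + 1ℤ))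
          r₆ = solve-∀

        run : ∀ n {K T} → (∀ q → q ℕ.< n → T + + q ≉ 0ℤ) → (K , T) ~ (K , T + + n)
        run zero {K} {T} hT = ~-resp ≈-refl (≡⇒≈ (lemma T))
          where
          lemma : ∀ T → T ≡ T + 0ℤ
          lemma = solve-∀
        run (suc n) {K} {T} hT = ~-trans (run n (λ q q<n → hT q (ℕ.m<n⇒m<1+n q<n)))
          (step (≡⇒≈ (lemma T (+ n))) (inj₁ (hT n (ℕ.n<1+n n) , ≈-refl)))
          where
          lemma : ∀ K n → K + (1ℤ + n) ≡ K + n + 1ℤ
          lemma = solve-∀

        to-T≈0 : ∀ K T → (K , T) ~ (K , 0ℤ)
        to-T≈0 K T = ~-trans (run (toℕ q) (λ k k<q z → below k<q (toℕ<n q) (combine₂ (- 1ℤ) 1ℤ z (ι-red (- T)) (r₁ (ι q) (+ k) T))))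
          (~-resp ≈-refl (combine₁ 1ℤ (ι-red (- T)) (r₂ (ι q) T)))
          where
          q = red (- T)
          r₁ : ∀ q k T → q - k - 0ℤ ≡ - 1ℤ * (T + k - 0ℤ) + 1ℤ * (q - - T)
          r₁ = solve-∀
          r₂ : ∀ q T → T + q - 0ℤ ≡ 1ℤ * (q - - T)
          r₂ = solve-∀

        shifts : ∀ n K → (K , 0ℤ) ~ (K + N * x * + n , 0ℤ)
        shifts zero    K = ~-resp (≡⇒≈ (lemma K (N * x))) ≈-refl
          where
          lemma : ∀ K c → K ≡ K + c * 0ℤ
          lemma = solve-∀
        shifts (suc n) K = ~-trans (shifts n K) (~-trans
          (step {K′ = K + N * x * + suc n} {T′ = 1ℤ} ≈-refl (inj₂ (≈-refl , ≡⇒≈ (lemma K (N * x) (+ n))))) (to-T≈0 _ 1ℤ))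
          where
          lemma : ∀ K c n → K + c * (1ℤ + n) ≡ K + c * n + c
          lemma = solve-∀

        all : ∀ s t → s ~ t
        all (K , T) (K′ , T′) = ~-trans (to-T≈0 K T) (~-trans (shifts (toℕ (proj₁ k)) K)
          (~-trans (~-resp (combine₁ 1ℤ (proj₂ k) (lemma K K′ (N * x) (ι (proj₁ k)))) ≈-refl) (~-sym (to-T≈0 K′ T′))))
          where
          k = divide Nx≉0 (K′ - K)
          lemma : ∀ K K′ c k → K + c * k - K′ ≡ 1ℤ * (c * k - (K′ - K))
          lemma = solve-∀

        everywhere : ∀ {i j} i′ j′ → S i j → S i′ j′
        everywhere {i} {j} i′ j′ q = S-resp (≡⇒≈ (lemma i′)) (coord j′)
          (proj₁ (directions (all (i , T j) (i′ , T j′))) (S-resp (≡⇒≈ (sym (lemma i))) (≈-sym (coord j)) q))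
          where
          T : ℤ → ℤ
          T j = ι (proj₁ (divide -x≉0 j))
          coord : ∀ z → - x * T z ≈ z
          coord z = proj₂ (divide -x≉0 z)
          lemma : ∀ j → 1ℤ * j ≡ j
          lemma = solve-∀

      everywhere : ¬ (x ≈ 0ℤ × y ≈ 0ℤ) → ∀ {i j} i′ j′ → S i j → S i′ j′
      everywhere nz with x ≈? 0ℤ | y ≈? 0ℤ
      ... | yes x≈0 | yes y≈0 = ⊥-elim (nz (x≈0 , y≈0))
      ... | yes x≈0 | no y≉0  = Horizontal.everywhere x≈0 y≉0
      ... | no x≉0  | yes y≈0 = Vertical.everywhere x≉0 y≈0
      ... | no x≉0  | no y≉0  = Generic.everywhere x≉0 y≉0

-- The acyclic colouring with p² + 2 colours.

module Colouring where

  open import Defs using (AcyclicColorable; K)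
  open ClosedSets
  open Residues
  open Orbits
  open Arcs
  open import Data.Nat as ℕ using (ℕ; zero; suc; s≤s; z≤n)
  import Data.Nat.Properties as ℕ
  open import Data.Nat.Primality using (Prime)
  open import Data.Integer using (ℤ; +_; -_; _+_; _*_; _-_; 0ℤ; 1ℤ)
  open import Data.Integer.Properties using (pos-+; pos-*)
  open import Data.Integer.Tactic.RingSolver using (solve-∀)
  open import Data.Fin using (Fin; zero; suc; toℕ; fromℕ<; combine; remQuot; splitAt; _↑ˡ_; _↑ʳ_)
  open import Data.Fin.Properties using (toℕ<n; toℕ-injective; toℕ-fromℕ<; combine-remQuot; remQuot-combine; splitAt-↑ˡ; splitAt-↑ʳ)
  open import Relation.Nullary.Decidable using (map′; _×-dec_)

  data Extra : Set where
    P Q : Extra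

  pick : {G : Set} {A : Extra → Set} → (∀ e → Dec (A e)) → G → G ⊎ Extra
  pick d g with d P | d Q
  ... | yes _ | _     = inj₂ P
  ... | no _  | yes _ = inj₂ Q
  ... | no _  | no _  = inj₁ g

  pick-extra : ∀ {G : Set} {A : Extra → Set} (d : ∀ e → Dec (A e)) {g : G} {e} → pick d g ≡ inj₂ e → A e
  pick-extra d eq with d P | d Q
  pick-extra d refl | yes a | _     = a
  pick-extra d refl | no _  | yes a = a

  pick-plain : ∀ {G : Set} {A : Extra → Set} (d : ∀ e → Dec (A e)) {g g′ : G} → pick d g ≡ inj₁ g′ → g ≡ g′ × ∀ e → ¬ A e
  pick-plain d eq with d P | d Q
  pick-plain d refl | no ¬a | no ¬b = refl , λ { P → ¬a ; Q → ¬b }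

  swap-closed : ∀ {V C : Set} {c : V → V → C} {a b} → Closed c a b → Closed c b a
  swap-closed cl = record
    { L = L ; R = R ; inhabited = inhabited
    ; L-next = λ l z h → L-next l z (Sum.swap h) ; R-next = λ r z h → R-next r z (Sum.swap h) }
    where open Closed cl

  remQuot-inj : ∀ {m} k {u v : Fin (m ℕ.* k)} → remQuot {m} k u ≡ remQuot {m} k v → u ≡ v
  remQuot-inj {m} k {u} {v} e = trans (sym (combine-remQuot {m} k u))
    (trans (cong (λ w → combine (proj₁ w) (proj₂ w)) e) (combine-remQuot {m} k v))

  module Construction (m : ℕ) (2≤m : 2 ℕ.≤ m) (prime : Prime (suc (m ℕ.+ m))) where
    open Modular m 2≤m prime
    open BlockWalks m 2≤m prime

    N : ℤ
    N = proj₁ anisotropic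

    N-anisotropic : ∀ x y → y * y ≈ N * x * x → x ≈ 0ℤ × y ≈ 0ℤ
    N-anisotropic = proj₂ anisotropic

    -- 1 is a square and `N` is not. Up to sign this is the determinant of the system that
    -- determines the base colour between the two blocks 0; for other pairs of blocks the
    -- determinant is 1.
    N-1≉0 : N - 1ℤ ≉ 0ℤ
    N-1≉0 h = 1≉0 (proj₁ (N-anisotropic 1ℤ 1ℤ (combine₁ (- 1ℤ) h (lemma N))))
      where
      lemma : ∀ N → 1ℤ * 1ℤ - N * 1ℤ * 1ℤ ≡ - 1ℤ * (N - 1ℤ - 0ℤ)
      lemma = solve-∀

    V C : Set
    V = Fin p × Fin p
    C = V ⊎ Extra

    at : Fin p → ℤ → ℤ → ℤ
    at zero    a b = a + b
    at (suc _) a b = a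

    at-pos : ∀ {i} a b → 0 ℕ.< toℕ i → at i a b ≡ a
    at-pos {suc i} a b _ = refl

    BaseEdge : V → V → V → Set
    BaseEdge (x , y) (i , t) (j , s) =
      ι t - ι j ≈ at i (ι x) (ι y) × ι s - ι i ≈ at j (ι y) (N * ι x)

    abstract
      solve-plain : ∀ T S → ∃ λ x → ∃ λ y → T ≈ ι x × S ≈ ι y
      solve-plain T S = red T , red S , ≈-sym (ι-red T) , ≈-sym (ι-red S)

      solve-left : ∀ T S → ∃ λ x → ∃ λ y → T ≈ ι x + ι y × S ≈ ι y
      solve-left T S = red (T - S) , red S ,
        combine₂ (- 1ℤ) (- 1ℤ) (ι-red (T - S)) (ι-red S) (lemma T S (ι (red (T - S))) (ι (red S))) , ≈-sym (ι-red S)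
        where
        lemma : ∀ T S x y → T - (x + y) ≡ - 1ℤ * (x - (T - S)) + - 1ℤ * (y - S)
        lemma = solve-∀

      solve-right : ∀ T S → ∃ λ x → ∃ λ y → T ≈ ι x × S ≈ ι y + N * ι x
      solve-right T S = red T , red (S - N * T) , ≈-sym (ι-red T) ,
        combine₂ (- N) (- 1ℤ) (ι-red T) (ι-red (S - N * T)) (lemma T S N (ι (red T)) (ι (red (S - N * T))))
        where
        lemma : ∀ T S N x y → S - (y + N * x) ≡ - N * (x - T) + - 1ℤ * (y - (S - N * T))
        lemma = solve-∀

      solve-both : ∀ T S → ∃ λ x → ∃ λ y → T ≈ ι x + ι y × S ≈ ι y + N * ι x
      solve-both T S = x , red (T - ι x) ,
        combine₁ (- 1ℤ) (ι-red (T - ι x)) (lemma₁ T (ι x) (ι (red (T - ι x)))) ,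
        combine₂ (- 1ℤ) (- 1ℤ) (proj₂ (divide N-1≉0 (S - T))) (ι-red (T - ι x)) (lemma₂ T S N (ι x) (ι (red (T - ι x))))
        where
        x : Fin p
        x = proj₁ (divide N-1≉0 (S - T))
        lemma₁ : ∀ T x y → T - (x + y) ≡ - 1ℤ * (y - (T - x))
        lemma₁ = solve-∀
        lemma₂ : ∀ T S N x y → S - (y + N * x) ≡ - 1ℤ * ((N - 1ℤ) * x - (S - T)) + - 1ℤ * (y - (T - x))
        lemma₂ = solve-∀

      base : ∀ u v → ∃ λ g → BaseEdge g u v
      base (i , t) (j , s) = go i j (ι t - ι j) (ι s - ι i)
        where
        pair : {A : Fin p → Fin p → Set} → (∃ λ x → ∃ λ y → A x y) → ∃ λ (g : V) → A (proj₁ g) (proj₂ g)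
        pair (x , y , h) = (x , y) , h
        go : ∀ i j T S → ∃ λ (g : V) → T ≈ at i (ι (proj₁ g)) (ι (proj₂ g)) × S ≈ at j (ι (proj₂ g)) (N * ι (proj₁ g))
        go (suc _) (suc _) T S = pair (solve-plain T S)
        go zero    (suc _) T S = pair (solve-left T S)
        go (suc _) zero    T S = pair (solve-right T S)
        go zero    zero    T S = pair (solve-both T S)

    difference-cancelˡ : ∀ a b c {z} → a - b ≈ z → a - c ≈ z → b ≈ c
    difference-cancelˡ a b c {z} h h′ = combine₂ (- 1ℤ) 1ℤ h h′ (lemma a b c z)
      where
      lemma : ∀ a b c z → b - c ≡ - 1ℤ * (a - b - z) + 1ℤ * (a - c - z)
      lemma = solve-∀

    difference-cancelʳ : ∀ a b c {z} → a - c ≈ z → b - c ≈ z → a ≈ b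
    difference-cancelʳ a b c {z} h h′ = combine₂ 1ℤ (- 1ℤ) h h′ (lemma a b c z)
      where
      lemma : ∀ a b c z → a - b ≡ 1ℤ * (a - c - z) + - 1ℤ * (b - c - z)
      lemma = solve-∀

    base-row : ∀ {g u v v′} → BaseEdge g u v → BaseEdge g u v′ → v ≡ v′
    base-row {u = i , t} {j , s} {j′ , s′} (h , k) (h′ , k′) with ι-inj {j} {j′} (difference-cancelˡ (ι t) (ι j) (ι j′) h h′)
    ... | refl = cong (j ,_) (ι-inj (difference-cancelʳ (ι s) (ι s′) (ι i) k k′))

    base-col : ∀ {g u u′ v} → BaseEdge g u v → BaseEdge g u′ v → u ≡ u′
    base-col {u = i , t} {i′ , t′} {j , s} (h , k) (h′ , k′) with ι-inj {i} {i′} (difference-cancelˡ (ι s) (ι i) (ι i′) k k′)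
    ... | refl = cong (i ,_) (ι-inj (difference-cancelʳ (ι t) (ι t′) (ι j) h h′))

    offset size : Extra → ℕ
    offset P = 1
    offset Q = m
    size P = m
    size Q = suc m

    offset-pos : ∀ e → 0 ℕ.< offset e
    offset-pos P = s≤s z≤n
    offset-pos Q = ℕ.≤-trans (s≤s z≤n) 2≤m

    Block : Extra → Fin p → Fin p → Set
    Block e i j = ∃ λ ℓ → ℓ ℕ.< size e × toℕ i ≡ offset e ℕ.+ ℓ × toℕ j ≡ suc ℓ

    block? : ∀ e i j → Dec (Block e i j)
    block? e i zero    = no λ ()
    block? e i (suc j) = map′ (λ { (h , k) → toℕ j , h , k , refl }) (λ { (_ , h , k , refl) → h , k })
      ((toℕ j ℕ.<? size e) ×-dec (toℕ i ℕ.≟ offset e ℕ.+ toℕ j))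

    Special : Extra → V → V → Set
    Special e (i , t) (j , s) = Block e i j × ι s ≈ - + 2 * ι t

    special? : ∀ u v e → Dec (Special e u v)
    special? (i , t) (j , s) e = block? e i j ×-dec (ι s ≈? - + 2 * ι t)

    abstract
      colour : V → V → C
      colour u v = pick (special? u v) (proj₁ (base u v))

      colour-extra : ∀ {u v e} → colour u v ≡ inj₂ e → Special e u v
      colour-extra {u} {v} = pick-extra (special? u v)

      colour-base : ∀ {u v g} → colour u v ≡ inj₁ g → BaseEdge g u v × ∀ e → ¬ Special e u v
      colour-base {u} {v} eq = subst (λ g → BaseEdge g u v) (proj₁ (pick-plain (special? u v) eq)) (proj₂ (base u v)) ,
        proj₂ (pick-plain (special? u v) eq)

    -2-cancel : ∀ {t t′} → - + 2 * ι t ≈ - + 2 * ι t′ → t ≡ t′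
    -2-cancel {t} {t′} h = ι-inj (cancel 2≉0 (combine₁ (- 1ℤ) h (lemma (ι t) (ι t′))))
      where
      lemma : ∀ t t′ → + 2 * t - + 2 * t′ ≡ - 1ℤ * (- + 2 * t - - + 2 * t′)
      lemma = solve-∀

    special-row : ∀ {e u v v′} → Special e u v → Special e u v′ → v ≡ v′
    special-row {e} {v = j , s} {j′ , s′} ((ℓ , _ , a , b) , h) ((ℓ′ , _ , a′ , b′) , h′) = cong₂ _,_
      (toℕ-injective (trans b (trans (cong suc (ℕ.+-cancelˡ-≡ (offset e) ℓ ℓ′ (trans (sym a) a′))) (sym b′))))
      (ι-inj (≈-trans h (≈-sym h′)))

    special-col : ∀ {e u u′ v} → Special e u v → Special e u′ v → u ≡ u′
    special-col {e} {i , t} {i′ , t′} ((ℓ , _ , a , b) , h) ((ℓ′ , _ , a′ , b′) , h′) = cong₂ _,_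
      (toℕ-injective (trans a (trans (cong (offset e ℕ.+_) (ℕ.suc-injective (trans (sym b) b′))) (sym a′))))
      (-2-cancel (≈-trans (≈-sym h) h′))

    colour-row : ∀ {u v v′} → colour u v ≡ colour u v′ → v ≡ v′
    colour-row {u} {v} {v′} eq = go (colour u v′) eq refl
      where
      go : ∀ z → colour u v ≡ z → colour u v′ ≡ z → v ≡ v′
      go (inj₁ g) q q′ = base-row {u = u} (proj₁ (colour-base q)) (proj₁ (colour-base q′))
      go (inj₂ e) q q′ = special-row {u = u} (colour-extra q) (colour-extra q′)

    colour-col : ∀ {u u′ v} → colour u v ≡ colour u′ v → u ≡ u′
    colour-col {u} {u′} {v} eq = go (colour u′ v) eq refl
      where
      go : ∀ z → colour u v ≡ z → colour u′ v ≡ z → u ≡ u′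
      go (inj₁ g) q q′ = base-col {v = v} (proj₁ (colour-base q)) (proj₁ (colour-base q′))
      go (inj₂ e) q q′ = special-col {v = v} (colour-extra q) (colour-extra q′)

    -- Blocks of `P` have i at most m, those of `Q` at least m, so every left vertex lies in block
    -- m. From there `P` leads to block j = m and `Q` to block j = 1, so a common right vertex
    -- forces m = 1.
    no-PQ : ¬ Closed colour (inj₂ P) (inj₂ Q)
    no-PQ cl with inhabited
      where open Closed cl
    ... | u , l with Closed.L-next cl l (inj₂ P) (inj₁ refl) | Closed.L-next cl l (inj₂ Q) (inj₂ refl)
    ...   | v , r , q | _ , _ , q₂ with colour-extra q | colour-extra q₂ | Closed.R-next cl r (inj₂ Q) (inj₂ refl)
    ...     | (ℓ , _ , i≡ , j≡) , _ | (ℓ₂ , _ , i≡₂ , _) , _ | u′ , l′ , q′ with colour-extra q′ | Closed.L-next cl l′ (inj₂ P) (inj₁ refl)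
    ...       | (ℓ′ , _ , i≡′ , j≡′) , _ | _ , _ , q″ with colour-extra q″
    ...         | (ℓ″ , ℓ″<m , i≡″ , _) , _ = ℕ.<⇒≱ 2≤m m≤1
      where
      ℓ′≡0 : ℓ′ ≡ 0
      ℓ′≡0 = ℕ.n≤0⇒n≡0 (ℕ.+-cancelˡ-≤ m ℓ′ 0 (ℕ.≤-trans (ℕ.≤-reflexive (trans (sym i≡′) i≡″))
               (ℕ.≤-trans ℓ″<m (ℕ.≤-reflexive (sym (ℕ.+-identityʳ m))))))
      m≤1 : m ℕ.≤ 1
      m≤1 = ℕ.≤-trans (ℕ.m≤m+n m ℓ₂) (ℕ.≤-reflexive (trans (sym i≡₂) (trans i≡
              (cong suc (trans (ℕ.suc-injective (trans (sym j≡) j≡′)) ℓ′≡0)))))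

    module Mixed (e : Extra) (x y : Fin p) (cl : Closed colour (inj₂ e) (inj₁ (x , y))) where
      open Closed cl

      -- One round along the extra colour and back along the base colour. The equation for `t′` is
      -- guarded because block `i′` is known to be nonzero only from the following round, where it
      -- meets the extra colour.
      record Step (i t i′ t′ : Fin p) : Set where
        field
          {j s} : Fin p
          {ℓ}   : ℕ
          moves : (i , t) ≡ (i′ , t′) → ⊥
          i≡    : toℕ i ≡ offset e ℕ.+ ℓ
          ℓ<    : ℓ ℕ.< size e
          j≡    : toℕ j ≡ suc ℓ
          s≈    : ι s ≈ - + 2 * ι t
          t′≈   : 0 ℕ.< toℕ i′ → ι t′ - ι j ≈ ι x
          s≈′   : ι s - ι i′ ≈ ι y

      step : ∀ {i t} → L (i , t) → ∃ λ i′ → ∃ λ t′ → L (i′ , t′) × Step i t i′ t′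
      step {i} {t} l with L-next l (inj₂ e) (inj₁ refl)
      ... | (j , s) , r , q with R-next r (inj₁ (x , y)) (inj₂ refl)
      ...   | (i′ , t′) , l′ , q′ = i′ , t′ , l′ , make (colour-extra q) (proj₁ (colour-base q′))
        where
        different : (i , t) ≡ (i′ , t′) → ⊥
        different refl with trans (sym q) q′
        ... | ()
        make : Special e (i , t) (j , s) → BaseEdge (x , y) (i′ , t′) (j , s) → Step i t i′ t′
        make ((ℓ , ℓ< , i≡ , j≡) , s≈) (h , k) = record
          { moves = different ; i≡ = i≡ ; ℓ< = ℓ< ; j≡ = j≡ ; s≈ = s≈
          ; t′≈ = λ pos → subst (ι t′ - ι j ≈_) (at-pos (ι x) (ι y) pos) h
          ; s≈′ = subst (ι s - ι i′ ≈_) (at-pos (ι y) (N * ι x) (subst (0 ℕ.<_) (sym j≡) (s≤s z≤n))) k }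

      Λ : ℕ → Set
      Λ ℓ = ℓ ℕ.< size e × ∃ λ i → ∃ λ t → L (i , t) × toℕ i ≡ offset e ℕ.+ ℓ

      size≤ : ∀ e → size e ℕ.≤ suc m
      size≤ P = ℕ.n≤1+n m
      size≤ Q = ℕ.≤-refl

      bounded : ∀ {ℓ} → Λ ℓ → ℓ ℕ.≤ m
      bounded (ℓ< , _) = ℕ.≤-pred (ℕ.≤-trans ℓ< (size≤ e))

      -- The constant in ℓ″ = -2ℓ + `target`, found by substituting t′ = ℓ + 1 + x and s′ = -2t′
      -- into offset + ℓ″ = s′ - y.
      target : ℤ
      target = - + 2 * ι x - ι y - + 2 - + offset e

      c : ℕ
      c = toℕ (red target)

      -- After one round `t′` depends on the block alone and the initial `t` is forgotten, so over
      -- two rounds the block index evolves by itself.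
      two-steps : ∀ {i t i′ t′ i″ t″} (S : Step i t i′ t′) (S′ : Step i′ t′ i″ t″) {ℓ″ : ℕ} →
        toℕ i″ ≡ offset e ℕ.+ ℓ″ → + (ℓ″ ℕ.+ 2 ℕ.* Step.ℓ S) ≈ target
      two-steps {i} {t} {i′} {t′} {i″} S S′ {ℓ″} i″≡ = subst (_≈ target)
        (sym (trans (pos-+ ℓ″ (2 ℕ.* S.ℓ)) (cong (λ z → + ℓ″ + z) (pos-* 2 S.ℓ))))
        (combine₃ (- 1ℤ) 1ℤ (- + 2) S′.s≈′ S′.s≈ (S.t′≈ i′>0)
          (lemma (+ ℓ″) (+ S.ℓ) (+ offset e) (ι x) (ι y) (ι S′.s) (ι t′) (ι i″) (ι S.j)
            (trans (cong +_ i″≡) (pos-+ (offset e) ℓ″)) (cong +_ S.j≡)))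
        where
        module S = Step S
        module S′ = Step S′
        i′>0 : 0 ℕ.< toℕ i′
        i′>0 = subst (0 ℕ.<_) (sym S′.i≡) (ℕ.<-≤-trans (offset-pos e) (ℕ.m≤m+n (offset e) S′.ℓ))
        identity : ∀ l″ l o x y s t →
          l″ + + 2 * l - (- + 2 * x - y - + 2 - o) ≡
          - 1ℤ * (s - (o + l″) - y) + 1ℤ * (s - - + 2 * t) + - + 2 * (t - (1ℤ + l) - x)
        identity = solve-∀
        lemma : ∀ l″ l o x y s t i j → i ≡ o + l″ → j ≡ 1ℤ + l →
          l″ + + 2 * l - (- + 2 * x - y - + 2 - o) ≡
          - 1ℤ * (s - i - y) + 1ℤ * (s - - + 2 * t) + - + 2 * (t - j - x)
        lemma l″ l o x y s t _ _ refl refl = identity l″ l o x y s t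

      split : ∀ {a} → a ℕ.< p ℕ.+ p → + a ≈ target → a ≡ c ⊎ a ≡ c ℕ.+ p
      split {a} a< h with a ℕ.<? p
      ... | yes a<p = inj₁ (nat-≈ a<p (toℕ<n (red target)) (≈-trans h (≈-sym (ι-red target))))
      ... | no a≮p = inj₂ (trans (sym (ℕ.m∸n+n≡m p≤a)) (cong (ℕ._+ p) (nat-≈ a∸p<p (toℕ<n (red target))
              (combine₃ 1ℤ (- 1ℤ) (- 1ℤ) h p≈0 (ι-red target)
                (lemma (+ a) (+ (a ℕ.∸ p)) (+ p) target (ι (red target)) (trans (cong +_ (sym (ℕ.m∸n+n≡m p≤a))) (pos-+ (a ℕ.∸ p) p)))))))
        where
        p≤a : p ℕ.≤ a
        p≤a = ℕ.≮⇒≥ a≮p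
        a∸p<p : a ℕ.∸ p ℕ.< p
        a∸p<p = ℕ.+-cancelʳ-< p (a ℕ.∸ p) p (subst (ℕ._< p ℕ.+ p) (sym (ℕ.m∸n+n≡m p≤a)) a<)
        identity : ∀ b q T r → b - r ≡ 1ℤ * (b + q - T) + - 1ℤ * (q - 0ℤ) + - 1ℤ * (r - T)
        identity = solve-∀
        lemma : ∀ a b q T r → a ≡ b + q → b - r ≡ 1ℤ * (a - T) + - 1ℤ * (q - 0ℤ) + - 1ℤ * (r - T)
        lemma _ b q T r refl = identity b q T r

      next : ∀ {ℓ} → Λ ℓ → ∃ λ ℓ″ → Λ ℓ″ × (ℓ″ ℕ.+ 2 ℕ.* ℓ ≡ c ⊎ ℓ″ ℕ.+ 2 ℕ.* ℓ ≡ c ℕ.+ p)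
      next {ℓ} lℓ@(_ , i , t , l , i≡) with step l
      ... | i′ , t′ , l′ , S with step l′
      ...   | i″ , t″ , l″ , S′ with step l″
      ...     | _ , _ , _ , S″ = Step.ℓ S″ , lℓ″ ,
                split (ℕ.≤-<-trans (ℕ.+-mono-≤ (bounded lℓ″) (ℕ.*-monoʳ-≤ 2 (bounded lℓ))) bound)
                  (subst (λ k → + (Step.ℓ S″ ℕ.+ 2 ℕ.* k) ≈ target)
                    (ℕ.+-cancelˡ-≡ (offset e) _ _ (trans (sym (Step.i≡ S)) i≡)) (two-steps S S′ (Step.i≡ S″)))
        where
        lℓ″ : Λ (Step.ℓ S″)
        lℓ″ = Step.ℓ< S″ , i″ , t″ , l″ , Step.i≡ S″
        bound : m ℕ.+ 2 ℕ.* m ℕ.< p ℕ.+ p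
        bound = s≤s (ℕ.+-mono-≤ (ℕ.m≤m+n m m) (ℕ.≤-trans (ℕ.≤-reflexive (cong (m ℕ.+_) (ℕ.+-identityʳ m))) (ℕ.n≤1+n (m ℕ.+ m))))

      2m<p : 2 ℕ.* m ℕ.< p
      2m<p = s≤s (ℕ.≤-reflexive (cong (m ℕ.+_) (ℕ.+-identityʳ m)))

      -- Each index is a fixed point, 3ℓ = c modulo p, and 3 is invertible.
      all-equal : ∀ {ℓ ℓ′} → Λ ℓ → Λ ℓ′ → ℓ ≡ ℓ′
      all-equal {ℓ} {ℓ′} l l′ = nat-≈ (ℕ.≤-<-trans (bounded l) m<p) (ℕ.≤-<-trans (bounded l′) m<p)
        (cancel 3≉0 (≈-trans (triple l) (≈-sym (triple l′))))
        where
        from : ∀ {ℓ} → 3 ℕ.* ℓ ≡ c ⊎ 3 ℕ.* ℓ ≡ c ℕ.+ p → + 3 * + ℓ ≈ + c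
        from {ℓ} (inj₁ q) = ≡⇒≈ (trans (sym (pos-* 3 ℓ)) (cong +_ q))
        from {ℓ} (inj₂ q) = ≈-trans (≡⇒≈ (trans (sym (pos-* 3 ℓ)) (trans (cong +_ q) (pos-+ c p)))) (combine₁ 1ℤ p≈0 (lemma (+ c) (+ p)))
          where
          lemma : ∀ c q → c + q - c ≡ 1ℤ * (q - 0ℤ)
          lemma = solve-∀
        triple : ∀ {ℓ} → Λ ℓ → + 3 * + ℓ ≈ + c
        triple {ℓ} l = from {ℓ} (arc-fixed Λ 2m<p (λ {ℓ} → bounded {ℓ}) (λ {ℓ} → next {ℓ}) l)

      -- With all left vertices in one block i, s = i + y is constant, and so is t because s = -2t.
      -- A round then returns to its starting vertex, and one edge has two colours.
      impossible : ⊥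
      impossible with inhabited
      ... | (i , t) , l with step l
      ...   | i′ , t′ , l′ , S with step l′
      ...     | i″ , t″ , l″ , S′ with step l″
      ...       | _ , _ , _ , S″ = S.moves (cong₂ _,_ i≡i′ t≡t′)
        where
        module S = Step S
        module S′ = Step S′
        module S″ = Step S″
        i≡i′ : i ≡ i′
        i≡i′ = toℕ-injective (trans S.i≡ (trans (cong (offset e ℕ.+_)
          (all-equal (S.ℓ< , i , t , l , S.i≡) (S′.ℓ< , i′ , t′ , l′ , S′.i≡))) (sym S′.i≡)))
        i′≡i″ : i′ ≡ i″
        i′≡i″ = toℕ-injective (trans S′.i≡ (trans (cong (offset e ℕ.+_)
          (all-equal (S′.ℓ< , i′ , t′ , l′ , S′.i≡) (S″.ℓ< , i″ , t″ , l″ , S″.i≡))) (sym S″.i≡)))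
        s≈s′ : ι S.s ≈ ι S′.s
        s≈s′ = difference-cancelʳ (ι S.s) (ι S′.s) (ι i′) S.s≈′ (subst (λ k → ι S′.s - ι k ≈ ι y) (sym i′≡i″) S′.s≈′)
        t≡t′ : t ≡ t′
        t≡t′ = -2-cancel (≈-trans (≈-sym S.s≈) (≈-trans s≈s′ S′.s≈))

    -- Both cases use the root k of 3k = -3 - 2x - y: `P` takes ℓ = k below m, `Q` takes ℓ = k - m
    -- otherwise, and 2m = -1 modulo p reconciles the two equations.
    recoloured : ∀ x y → ∃ λ e → ∃ λ i → ∃ λ j → Block e i j × ι i + y ≈ - + 2 * (ι j + x)
    recoloured x y = go (toℕ z) (toℕ<n z) (proj₂ (divide 3≉0 (- + 3 - + 2 * x - y)))
      where
      z = proj₁ (divide 3≉0 (- + 3 - + 2 * x - y))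
      go : ∀ k → k ℕ.< p → + 3 * + k ≈ - + 3 - + 2 * x - y →
        ∃ λ e → ∃ λ i → ∃ λ j → Block e i j × ι i + y ≈ - + 2 * (ι j + x)
      go k k<p h with k ℕ.<? m
      ... | yes k<m = P , i , i , (k , k<m , i≡ , i≡) , combine₁ 1ℤ h (lemma (ι i) (+ k) x y (cong +_ i≡))
        where
        1+k<p : suc k ℕ.< p
        1+k<p = ℕ.≤-<-trans k<m m<p
        i : Fin p
        i = fromℕ< 1+k<p
        i≡ : toℕ i ≡ suc k
        i≡ = toℕ-fromℕ< 1+k<p
        identity : ∀ k x y → 1ℤ + k + y - - + 2 * (1ℤ + k + x) ≡ 1ℤ * (+ 3 * k - (- + 3 - + 2 * x - y))
        identity = solve-∀
        lemma : ∀ i k x y → i ≡ 1ℤ + k → i + y - - + 2 * (i + x) ≡ 1ℤ * (+ 3 * k - (- + 3 - + 2 * x - y))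
        lemma _ k x y refl = identity k x y
      ... | no k≮m = Q , i , j , (ℓ , s≤s ℓ≤m , trans i≡ (sym m+ℓ≡k) , j≡) ,
          combine₂ 1ℤ (- 1ℤ) h p≈0 (lemma (ι i) (ι j) (+ k) (+ ℓ) (+ m) x y (+ p)
            (cong +_ i≡) (trans (cong +_ (sym m+ℓ≡k)) (pos-+ m ℓ)) (cong +_ j≡) (trans (pos-+ 1 (m ℕ.+ m)) (cong (λ z → 1ℤ + z) (pos-+ m m))))
        where
        ℓ : ℕ
        ℓ = k ℕ.∸ m
        m+ℓ≡k : m ℕ.+ ℓ ≡ k
        m+ℓ≡k = ℕ.m+[n∸m]≡n (ℕ.≮⇒≥ k≮m)
        ℓ≤m : ℓ ℕ.≤ m
        ℓ≤m = ℕ.+-cancelˡ-≤ m ℓ m (subst (ℕ._≤ m ℕ.+ m) (sym m+ℓ≡k) (ℕ.≤-pred k<p))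
        1+ℓ<p : suc ℓ ℕ.< p
        1+ℓ<p = s≤s (ℕ.≤-trans (s≤s ℓ≤m) (ℕ.+-monoˡ-≤ m (ℕ.≤-trans (s≤s z≤n) 2≤m)))
        i j : Fin p
        i = fromℕ< k<p
        j = fromℕ< 1+ℓ<p
        i≡ : toℕ i ≡ k
        i≡ = toℕ-fromℕ< k<p
        j≡ : toℕ j ≡ suc ℓ
        j≡ = toℕ-fromℕ< 1+ℓ<p
        identity : ∀ l m x y → m + l + y - - + 2 * (1ℤ + l + x) ≡
          1ℤ * (+ 3 * (m + l) - (- + 3 - + 2 * x - y)) + - 1ℤ * (1ℤ + (m + m) - 0ℤ)
        identity = solve-∀
        lemma : ∀ i j k l m x y q → i ≡ k → k ≡ m + l → j ≡ 1ℤ + l → q ≡ 1ℤ + (m + m) →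
          i + y - - + 2 * (j + x) ≡ 1ℤ * (+ 3 * k - (- + 3 - + 2 * x - y)) + - 1ℤ * (q - 0ℤ)
        lemma _ _ _ l m x y _ refl refl refl refl = identity l m x y

    module Base (x y x′ y′ : Fin p) (g≢g′ : (x , y) ≢ (x′ , y′)) (cl : Closed colour (inj₁ (x , y)) (inj₁ (x′ , y′))) where
      open Closed cl

      dx dy : ℤ
      dx = ι x - ι x′
      dy = ι y - ι y′

      -- A pair of blocks is joined by exactly one edge of each base colour, so the pair identifies the edge.
      S : ℤ → ℤ → Set
      S i j = ∃ λ t → ∃ λ s → L (red i , t) × R (red j , s) × colour (red i , t) (red j , s) ≡ inj₁ (x , y)

      S-resp : ∀ {i j i′ j′} → i ≈ i′ → j ≈ j′ → S i j → S i′ j′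
      S-resp h h′ = subst₂ (λ i j → ∃ λ t → ∃ λ s → L (i , t) × R (j , s) × colour (i , t) (j , s) ≡ inj₁ (x , y))
        (red-cong h) (red-cong h′)

      at-difference : ∀ i {a b a′ b′ z d d′ δ} → ι i ≈ z → Kick z d d′ δ → a - a′ ≈ d → b - b′ ≈ d′ → at i a b - at i a′ b′ ≈ δ
      at-difference zero {a} {b} {a′} {b′} {z} {d} {d′} {δ} _ (inj₂ (_ , q)) h h′ = combine₃ 1ℤ 1ℤ (- 1ℤ) h h′ q (lemma a b a′ b′ d d′ δ)
        where
        lemma : ∀ a b a′ b′ d d′ δ → a + b - (a′ + b′) - δ ≡ 1ℤ * (a - a′ - d) + 1ℤ * (b - b′ - d′) + - 1ℤ * (δ - (d + d′))
        lemma = solve-∀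
      at-difference zero    i≈ (inj₁ (z≉0 , _)) = ⊥-elim (z≉0 (≈-sym i≈))
      at-difference (suc i) i≈ (inj₁ (_ , q)) h _ = ≈-trans h (≈-sym q)
      at-difference (suc i) i≈ (inj₂ (z≈0 , _)) = ⊥-elim (nonzero-nat (s≤s z≤n) (toℕ<n (suc i)) (≈-trans i≈ z≈0))

      N-difference : N * ι x - N * ι x′ ≈ N * dx
      N-difference = ≡⇒≈ (lemma N (ι x) (ι x′))
        where
        lemma : ∀ N x x′ → N * x - N * x′ ≡ N * (x - x′)
        lemma = solve-∀

      found : ∀ {a b t s i j} → L (a , t) → R (b , s) → colour (a , t) (b , s) ≡ inj₁ (x , y) → ι a ≈ i → ι b ≈ j → S i j
      found {a} {b} {t} {s} l r q h h′ = subst₂ (λ a b → ∃ λ t → ∃ λ s → L (a , t) × R (b , s) × colour (a , t) (b , s) ≡ inj₁ (x , y))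
        (trans (sym (red-ι a)) (red-cong h)) (trans (sym (red-ι b)) (red-cong h′)) (t , s , l , r , q)

      move⁺ : ∀ s i a {I U U′ δ} → s - i ≈ U → s - a ≈ U′ → U - U′ ≈ δ → i ≈ I → a ≈ I + δ
      move⁺ s i a {I} {U} {U′} {δ} h h′ d e = ≈-trans (combine₃ 1ℤ (- 1ℤ) 1ℤ h h′ d (lemma s i a U U′ δ)) (combine₁ 1ℤ e (lemma′ i I δ))
        where
        lemma : ∀ s i a U U′ δ → a - (i + δ) ≡ 1ℤ * (s - i - U) + - 1ℤ * (s - a - U′) + 1ℤ * (U - U′ - δ)
        lemma = solve-∀
        lemma′ : ∀ i I δ → i + δ - (I + δ) ≡ 1ℤ * (i - I)
        lemma′ = solve-∀

      move⁻ : ∀ s i a {I U U′ δ} → s - i ≈ U → s - a ≈ U′ → U′ - U ≈ δ → i ≈ I → a ≈ I - δ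
      move⁻ s i a {I} {U} {U′} {δ} h h′ d e = ≈-trans (combine₃ 1ℤ (- 1ℤ) (- 1ℤ) h h′ d (lemma s i a U U′ δ)) (combine₁ 1ℤ e (lemma′ i I δ))
        where
        lemma : ∀ s i a U U′ δ → a - (i - δ) ≡ 1ℤ * (s - i - U) + - 1ℤ * (s - a - U′) + - 1ℤ * (U′ - U - δ)
        lemma = solve-∀
        lemma′ : ∀ i I δ → i - δ - (I - δ) ≡ 1ℤ * (i - I)
        lemma′ = solve-∀

      undo⁺ : ∀ {i′ i δ} → i′ ≈ i + δ → i′ - δ ≈ i
      undo⁺ {i′} {i} {δ} h = combine₁ 1ℤ h (lemma i′ i δ)
        where
        lemma : ∀ i′ i δ → i′ - δ - i ≡ 1ℤ * (i′ - (i + δ))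
        lemma = solve-∀

      undo⁻ : ∀ {j′ j ε} → j′ ≈ j - ε → j′ + ε ≈ j
      undo⁻ {i′} {i} {δ} h = combine₁ 1ℤ h (lemma i′ i δ)
        where
        lemma : ∀ i′ i δ → i′ + δ - i ≡ 1ℤ * (i′ - (i - δ))
        lemma = solve-∀

      on-left : ∀ {g u v} → colour u v ≡ inj₁ g → ι (proj₂ u) - ι (proj₁ v) ≈ at (proj₁ u) (ι (proj₁ g)) (ι (proj₂ g))
      on-left q = proj₁ (proj₁ (colour-base q))

      on-right : ∀ {g u v} → colour u v ≡ inj₁ g → ι (proj₂ v) - ι (proj₁ u) ≈ at (proj₁ v) (ι (proj₂ g)) (N * ι (proj₁ g))
      on-right q = proj₂ (proj₁ (colour-base q))

      -- Subtracting the equations of the two colours at their common right vertex gives the change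
      -- of i; the same at the next left vertex gives the change of j.
      forward : ∀ {i j i′ j′ δ ε} → Kick j dy (N * dx) δ → i′ ≈ i + δ → Kick i′ dx dy ε → j′ ≈ j - ε → S i j → S i′ j′
      forward {i} {j} {i′} {j′} k hi k′ hj (t , s , l , r , q) with R-next r (inj₁ (x′ , y′)) (inj₂ refl)
      ... | (a , t′) , l′ , q′ with L-next l′ (inj₁ (x , y)) (inj₁ refl)
      ...   | (b , s′) , r′ , q″ = found l′ r′ q″ a≈ b≈
        where
        a≈ : ι a ≈ i′
        a≈ = ≈-trans (move⁺ (ι s) (ι (red i)) (ι a) (on-right q) (on-right q′) (at-difference (red j) (ι-red j) k ≈-refl N-difference) (ι-red i)) (≈-sym hi)
        b≈ : ι b ≈ j′
        b≈ = ≈-trans (move⁻ (ι t′) (ι (red j)) (ι b) (on-left q′) (on-left q″) (at-difference a a≈ k′ ≈-refl ≈-refl) (ι-red j)) (≈-sym hj)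

      backward : ∀ {i j i′ j′ δ ε} → Kick j dy (N * dx) δ → i′ ≈ i + δ → Kick i′ dx dy ε → j′ ≈ j - ε → S i′ j′ → S i j
      backward {i} {j} {i′} {j′} k hi k′ hj (t , s , l , r , q) with L-next l (inj₁ (x′ , y′)) (inj₂ refl)
      ... | (b , s′) , r′ , q′ with R-next r′ (inj₁ (x , y)) (inj₁ refl)
      ...   | (a , t′) , l′ , q″ = found l′ r′ q″ a≈ b≈
        where
        b≈ : ι b ≈ j
        b≈ = ≈-trans (move⁺ (ι t) (ι (red j′)) (ι b) (on-left q) (on-left q′) (at-difference (red i′) (ι-red i′) k′ ≈-refl ≈-refl) (ι-red j′)) (undo⁻ hj)
        a≈ : ι a ≈ i
        a≈ = ≈-trans (move⁻ (ι s′) (ι (red i′)) (ι a) (on-right q′) (on-right q″) (at-difference b b≈ k ≈-refl N-difference) (ι-red i′)) (undo⁺ hi)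

      dxy≉0 : ¬ (dx ≈ 0ℤ × dy ≈ 0ℤ)
      dxy≉0 (h , h′) = g≢g′ (cong₂ _,_ (ι-inj (combine₁ 1ℤ h (lemma (ι x) (ι x′)))) (ι-inj (combine₁ 1ℤ h′ (lemma (ι y) (ι y′)))))
        where
        lemma : ∀ a b → a - b ≡ 1ℤ * (a - b - 0ℤ)
        lemma = solve-∀

      some-S : ∃ λ i → ∃ λ j → S i j
      some-S with inhabited
      ... | (i , t) , l with L-next l (inj₁ (x , y)) (inj₁ refl)
      ...   | (j , s) , r , q = ι i , ι j , found l r q ≈-refl ≈-refl

      -- By transitivity the closed set contains an edge of colour (x , y) between every two blocks,
      -- in particular where that edge was given to `P` or `Q`.
      impossible : ⊥
      impossible = contradict (recoloured (ι x) (ι y))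
        where
        full : ∀ i j → S i j
        full i j = Orbit.everywhere N dx dy N-anisotropic S S-resp
          (λ k hi k′ hj → forward k hi k′ hj , backward k hi k′ hj) dxy≉0 i j (proj₂ (proj₂ some-S))
        missing : ∀ e {i j i′ j′ t s} → Block e i j → i′ ≡ i → j′ ≡ j → ι i + ι y ≈ - + 2 * (ι j + ι x) →
          colour (i′ , t) (j′ , s) ≡ inj₁ (x , y) → ⊥
        missing e {i} {j} {t = t} {s} bl@(ℓ , _ , i≡ , j≡) refl refl h q = proj₂ (colour-base q) e (bl , s≈)
          where
          t≈ : ι t - ι j ≈ ι x
          t≈ = subst (ι t - ι j ≈_) (at-pos (ι x) (ι y) (subst (0 ℕ.<_) (sym i≡) (ℕ.<-≤-trans (offset-pos e) (ℕ.m≤m+n (offset e) ℓ)))) (on-left q)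
          s≈y : ι s - ι i ≈ ι y
          s≈y = subst (ι s - ι i ≈_) (at-pos (ι y) (N * ι x) (subst (0 ℕ.<_) (sym j≡) (s≤s z≤n))) (on-right q)
          s≈ : ι s ≈ - + 2 * ι t
          s≈ = combine₃ 1ℤ 1ℤ (+ 2) s≈y h t≈ (lemma (ι i) (ι j) (ι t) (ι s) (ι x) (ι y))
            where
            lemma : ∀ i j t s x y → s - - + 2 * t ≡ 1ℤ * (s - i - y) + 1ℤ * (i + y - - + 2 * (j + x)) + + 2 * (t - j - x)
            lemma = solve-∀
        contradict : (∃ λ e → ∃ λ i → ∃ λ j → Block e i j × ι i + ι y ≈ - + 2 * (ι j + ι x)) → ⊥
        contradict (e , i , j , bl , h) = go (full (ι i) (ι j))
          where
          go : S (ι i) (ι j) → ⊥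
          go (t , s , _ , _ , q) = missing e bl (red-ι i) (red-ι j) h q

    no-closed : ∀ {a b} → a ≢ b → ¬ Closed colour a b
    no-closed {inj₁ (x , y)} {inj₁ (x′ , y′)} a≢b cl = Base.impossible x y x′ y′ (λ e → a≢b (cong inj₁ e)) cl
    no-closed {inj₁ (x , y)} {inj₂ e}         a≢b cl = Mixed.impossible e x y (swap-closed cl)
    no-closed {inj₂ e}       {inj₁ (x , y)}   a≢b cl = Mixed.impossible e x y cl
    no-closed {inj₂ P} {inj₂ P} a≢b cl = a≢b refl
    no-closed {inj₂ P} {inj₂ Q} a≢b cl = no-PQ cl
    no-closed {inj₂ Q} {inj₂ P} a≢b cl = no-PQ (swap-closed cl)
    no-closed {inj₂ Q} {inj₂ Q} a≢b cl = a≢b refl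

    encode : C → Fin (p ℕ.* p ℕ.+ 2)
    encode (inj₁ (x , y)) = combine x y ↑ˡ 2
    encode (inj₂ P)       = (p ℕ.* p) ↑ʳ zero
    encode (inj₂ Q)       = (p ℕ.* p) ↑ʳ suc zero

    decode : Fin (p ℕ.* p ℕ.+ 2) → C
    decode z with splitAt (p ℕ.* p) z
    ... | inj₁ xy         = inj₁ (remQuot p xy)
    ... | inj₂ zero       = inj₂ P
    ... | inj₂ (suc zero) = inj₂ Q

    decode-encode : ∀ a → decode (encode a) ≡ a
    decode-encode (inj₁ (x , y)) rewrite splitAt-↑ˡ (p ℕ.* p) (combine x y) 2 = cong inj₁ (remQuot-combine x y)
    decode-encode (inj₂ P) rewrite splitAt-↑ʳ (p ℕ.* p) 2 zero = refl
    decode-encode (inj₂ Q) rewrite splitAt-↑ʳ (p ℕ.* p) 2 (suc zero) = refl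

    encode-inj : ∀ {a b} → encode a ≡ encode b → a ≡ b
    encode-inj {a} {b} e = trans (sym (decode-encode a)) (trans (cong decode e) (decode-encode b))

    upper-bound : AcyclicColorable (K (p ℕ.* p)) (p ℕ.* p ℕ.+ 2)
    upper-bound = colourable colour (λ {u} {v} {v′} → colour-row {u} {v} {v′}) (λ {u} {u′} {v} → colour-col {u} {u′} {v}) no-closed
      (remQuot p) (remQuot-inj p) encode encode-inj

-- Parity of p and of its square.

module Odd where

  open import Data.Nat using (ℕ; zero; suc; _+_; _*_; _≤_; s≤s; _≤?_)
  open import Data.Nat.Properties using (+-suc; ≤-trans; ≤-reflexive; +-mono-≤; ≰⇒>; ≤-pred)
  open import Data.Nat.Divisibility using (divides)
  open import Data.Nat.Primality using (Prime; prime⇒irreducible)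
  open import Data.Nat.Tactic.RingSolver using (solve-∀)

  halve : ∀ n → ∃ λ m → n ≡ m + m ⊎ n ≡ suc (m + m)
  halve zero    = 0 , inj₁ refl
  halve (suc n) with halve n
  ... | m , inj₁ e = m , inj₂ (cong suc e)
  ... | m , inj₂ e = suc m , inj₁ (cong suc (trans e (sym (+-suc m m))))

  odd-prime : ∀ {p} → Prime p → 5 ≤ p → ∃ λ m → p ≡ suc (m + m) × 2 ≤ m
  odd-prime {p} pr 5≤p with halve p
  ... | m , inj₁ e = ⊥-elim (even (prime⇒irreducible pr (divides m (trans e (double m)))))
    where
    double : ∀ m → m + m ≡ m * 2
    double = solve-∀
    even : 2 ≡ 1 ⊎ 2 ≡ p → ⊥
    even (inj₂ q) with subst (5 ≤_) (sym q) 5≤p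
    ... | s≤s (s≤s ())
  ... | m , inj₂ e with 2 ≤? m
  ...   | yes 2≤m = m , e , 2≤m
  ...   | no 2≰m with ≤-trans 5≤p (≤-trans (≤-reflexive e) (s≤s (+-mono-≤ (≤-pred (≰⇒> 2≰m)) (≤-pred (≰⇒> 2≰m)))))
  ...     | s≤s (s≤s (s≤s ()))

  odd-square : ∀ m → suc (m + m) * suc (m + m) ≡ suc ((2 * m * m + 2 * m) + (2 * m * m + 2 * m))
  odd-square = solve-∀

open import Defs
open import Data.Nat using (ℕ; _+_; _*_; _≤_; s≤s; z≤n)
open import Data.Nat.Properties using (≤-trans; m≤m+n)
open import Data.Nat.Primality using (Prime)

theorem2 : (p : ℕ) → Prime p → 5 ≤ p →
    AcyclicChromaticIndex (K (p * p)) (p * p + 2)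
theorem2 p pr 5≤p with Odd.odd-prime pr 5≤p
... | m , refl , 2≤m = Colouring.Construction.upper-bound m 2≤m pr ,
  Lower.lower-bound (2 * m * m + 2 * m) (Odd.odd-square m) (s≤s (≤-trans (s≤s z≤n) (≤-trans 2≤m (≤-trans (m≤m+n m m) (m≤m+n (m + m) _)))))
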